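{- Define, for integers $k \geq 1$, \[ f(k) = \begin{cases} \lceil k/2 \rceil^{ -2} & \text{if } k \leq 6,\\ \dfrac{1}{2k-1} & \text{if } k \geq 7.\end{cases}\] (1) For every $\epsilon > 0$ there exists $n_0 \in \mathbb{N}$ such that for every $n \geq n_0$, every integer $k \geq 1$, and all (simple) graphs $G_1, G_2, \ldots, G_k$ on a common set of $n$ vertices, each having at least $(f(k)+\epsilon)\frac{n^2}{2}$ edges, there exists a rainbow path with 3 edges. (2) Moreover, this bound is asymptotically optimal for each $k \geq 1$: for every $k \geq 1$ and every $\delta > 0$, for all sufficiently large $n$ there exist graphs $G_1, \ldots, G_k$ on a common set of $n$ vertices, each having at least $(f(k)-\delta)\frac{n^2}{2}$ edges, with no rainbow path with 3 edges.
   Context: Given graphs $G_1, \ldots, G_k$ on a common vertex set $V$, a rainbow path with 3 edges is a sequence of four distinct vertices $v_0, v_1, v_2, v_3 \in V$ together with three distinct indices $i_1, i_2, i_3 \in [k]$ such that $v_{t-1}v_t$ is an edge of $G_{i_t}$ for $t = 1,2,3$ (i.e. each edge of the path comes from a different graph; an edge may belong to several of the graphs). -}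

module Defs where

open import Data.Bool using (Bool; true; false; T; _∧_)
open import Data.Nat using (ℕ; zero; suc; _+_; _*_)
open import Data.Fin using (Fin; toℕ)
open import Data.List using (List; map)
open import Data.Nat.ListAction using (sum)
open import Data.List.Base using (allFin)
open import Data.Integer using (+_)
open import Data.Rational using (ℚ; _/_; 0ℚ; 1ℚ)
open import Data.Product using (Σ; _×_; ∃-syntax)
open import Relation.Binary.PropositionalEquality using (_≡_)
open import Relation.Nullary using (¬_)
open import Relation.Nullary.Decidable using (⌊_⌋)
import Data.Nat as ℕ

record Graph (n : ℕ) : Set where
  field
    adj    : Fin n → Fin n → Bool
    sym    : ∀ i j → adj i j ≡ adj j i
    irrefl : ∀ i → adj i i ≡ false
open Graph public

Edge : ∀ {n} → Graph n → Fin n → Fin n → Set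
Edge G i j = T (adj G i j)

boolToℕ : Bool → ℕ
boolToℕ true  = 1
boolToℕ false = 0

edgeCount : ∀ {n} → Graph n → ℕ
edgeCount {n} G =
  sum (map (λ i → sum (map (λ j → boolToℕ (⌊ toℕ i ℕ.<? toℕ j ⌋ ∧ adj G i j)) (allFin n))) (allFin n))

Distinct3 : ∀ {A : Set} → A → A → A → Set
Distinct3 a b c = ¬ a ≡ b × ¬ a ≡ c × ¬ b ≡ c

Distinct4 : ∀ {A : Set} → A → A → A → A → Set
Distinct4 a b c d = ¬ a ≡ b × ¬ a ≡ c × ¬ a ≡ d × ¬ b ≡ c × ¬ b ≡ d × ¬ c ≡ d

RainbowP3 : ∀ {n k} → (Fin k → Graph n) → Set
RainbowP3 {n} {k} G =
  ∃[ v0 ] ∃[ v1 ] ∃[ v2 ] ∃[ v3 ] ∃[ i1 ] ∃[ i2 ] ∃[ i3 ]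
    (Distinct4 {Fin n} v0 v1 v2 v3 × Distinct3 {Fin k} i1 i2 i3 ×
     Edge (G i1) v0 v1 × Edge (G i2) v1 v2 × Edge (G i3) v2 v3)

-- f(k) = ⌈k/2⌉^(-2) for 1 ≤ k ≤ 6, and 1/(2k-1) for k ≥ 7.
-- (f 0 is a junk value; the theorem only uses k ≥ 1.)
f : ℕ → ℚ
f 0 = 0ℚ
f 1 = 1ℚ                         -- ⌈1/2⌉ = 1
f 2 = 1ℚ                         -- ⌈2/2⌉ = 1
f 3 = + 1 / 4                    -- ⌈3/2⌉ = 2
f 4 = + 1 / 4                    -- ⌈4/2⌉ = 2
f 5 = + 1 / 9                    -- ⌈5/2⌉ = 3
f 6 = + 1 / 9                    -- ⌈6/2⌉ = 3
f (suc (suc (suc (suc (suc (suc (suc m))))))) = + 1 / (13 + 2 * m)   -- 2(7+m)-1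

halfSq : ℕ → ℚ
halfSq n = + (n * n) / 2

ℕtoℚ : ℕ → ℚ
ℕtoℚ m = + m / 1

{-# OPTIONS --safe #-}

-- Upper bound. Let S(v) be the set of colours of degree at least 3 at v. If uv has colour j ∈ S(u) ∩ S(v)
-- and no rainbow path exists, then S(u) = {j}, or S(v) = {j}, or S(u) = S(v) = {i, j}. With b_i = #{S = {i}},
-- d_ij = #{S = {i, j}}, D_i = Σ_j d_ij and a = #{|S| ≥ 3}, colour i thus has at most M_i / 2 + O(n) edges, where
-- M_i = b_i² + 2 b_i (a + D_i) + Σ_j d_ij², while Σ_i (b_i + D_i / 2) + a ≤ n. Put P_i = 2 b_i + D_i. By convexity
-- M_i ≤ max (P_i², (P_i² + 4 a P_i) / 4). For an i with minimal P_i the second alternative gives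
-- (2k - 1) M_i ≤ n², and the first one k² M_i ≤ 4 n², which suffices for k = 4, 6 and k ≥ 8.
--
-- For k = 3, 5, 7 suppose that M_i ≥ ℓ² for all i and n < (k + 1) ℓ / 2. One first reduces to a = 0. Then the
-- excesses g_i = P_i - ℓ are nonnegative with sum below ℓ. Let π(i) maximise d_ij over j. All colours outside a set
-- of colours with g_i ≥ ℓ / 3 are matched in pairs by π; as k is odd, exactly one colour x is left. Inside a
-- pair {j, l} the deficit ℓ - b_j - b_l - d_jl is small compared with the product of the weights leaving the
-- pair, so that the excesses of all pairs add up to almost D_x, and this forces Σ g_i ≥ ℓ.
--
-- Lower bound. For k ≤ 6 take ⌈k/2⌉ disjoint cliques, each used for two colours; for k ≥ 7 take blocks B_i of
-- n / (2k - 1) vertices and let colour i join all pairs meeting B_i and no other block.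
module Submission where

open import Defs renaming (sym to adj-sym)
open import Data.Nat using (ℕ; _≥_)
open import Data.Fin using (Fin)
open import Data.Product using (_×_; _,_; ∃-syntax)
open import Relation.Nullary using (¬_)

module RainbowPaths where

  import Data.Fin as Fin
  import Data.List.Relation.Unary.Unique.Propositional.Properties as Unique
  import Data.Nat as ℕ
  import Data.Nat.DivMod as ℕ
  import Data.Nat.ListAction as ListAction
  import Data.Nat.Properties as ℕ
  import Data.Nat.Tactic.RingSolver as ℕ-Solver
  import Data.Rational.Properties as ℚ
  import Data.Rational.Unnormalised.Properties as ℚᵘ
  open import Data.Bool using (Bool; true; false; T; _∧_)
  open import Data.Empty using (⊥; ⊥-elim)
  open import Data.Fin using (zero; suc; toℕ; punchIn; punchOut)
  open import Data.Fin.Patterns using (0F; 1F; 2F)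
  open import Data.Fin.Permutation using (permutation)
  open import Data.Fin.Properties using (_≟_; all?; any?; <-cmp; toℕ-injective; toℕ<n)
  open import Data.Fin.Properties using (punchIn-punchOut; punchOut-injective; suc-injective)
  open import Data.Integer hiding (suc; _≟_; _/_)
  open import Data.Integer.Properties hiding (_≟_; <-cmp)
  open import Data.Integer.Tactic.RingSolver using (solve; solve-∀)
  open import Data.List as List using (List; _∷_; []; allFin; tabulate; filter)
  open import Data.List.Membership.Propositional using (_∈_)
  open import Data.List.Membership.Propositional.Properties using (∈-filter⁺; ∈-filter⁻; ∈-allFin)
  open import Data.List.Properties using (map-tabulate)
  open import Data.List.Relation.Unary.Any using (here; there)
  open import Data.List.Relation.Unary.Unique.Propositional using (Unique)
  open import Data.Product using (proj₁; proj₂; Σ-syntax)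
  open import Data.Rational as ℚ using (ℚ; mkℚ; 0ℚ; fromℚᵘ; toℚᵘ)
  open import Data.Rational.Unnormalised as ℚᵘ using (ℚᵘ; mkℚᵘ)
  open import Data.Sum using (_⊎_; inj₁; inj₂; [_,_]′)
  open import Data.Unit using (tt)
  open import Data.Vec as Vec using (Vec; lookup)
  open import Data.Vec.Functional using (removeAt)
  open import Function using (_∘_; id)
  open import Relation.Binary using (Decidable; Symmetric; tri<; tri≈; tri>)
  open import Relation.Binary.PropositionalEquality
  open import Relation.Nullary using (Dec; yes; no)
  open import Relation.Nullary.Decidable using (map′; _×-dec_; _⊎-dec_; _→-dec_; ¬?; T?)
  open import Relation.Nullary.Decidable using (⌊_⌋; True; toWitness; decidable-stable)
  open import Algebra.Properties.Semiring.Sum +-*-semiring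


  -- Certificates and sums

  infixl 6 _⊕_
  infixl 7 _⊗_

  _⊕_ : ∀ {x y} → 0ℤ ≤ x → 0ℤ ≤ y → 0ℤ ≤ x + y
  p ⊕ q = +-mono-≤ p q

  _⊗_ : ∀ {x y} → 0ℤ ≤ x → 0ℤ ≤ y → 0ℤ ≤ x * y
  _⊗_ {+ m} {+ n} p q rewrite sym (pos-* m n) = +≤+ ℕ.z≤n

  nat : ∀ n → 0ℤ ≤ + n
  nat n = +≤+ ℕ.z≤n

  sq : ∀ x → 0ℤ ≤ x * x
  sq (+ m)    = nat m ⊗ nat m
  sq -[1+ m ] = nat (ℕ.suc m) ⊗ nat (ℕ.suc m)

  -- A polynomial inequality is proved by a certificate: the difference of its sides is written as a sum of
  -- products of quantities known to be nonnegative, and the ring solver checks the identity. A refutation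
  -- writes -1 in this way.
  gap : ∀ {x y} → x ≤ y → 0ℤ ≤ y - x
  gap = i≤j⇒0≤j-i

  gap< : ∀ {x y} → x < y → 0ℤ ≤ y - (+ 1 + x)
  gap< = gap ∘ i<j⇒suc[i]≤j

  ≤-from : ∀ {x y z} → 0ℤ ≤ z → y - x ≡ z → x ≤ y
  ≤-from p refl = 0≤i-j⇒j≤i p

  <-from : ∀ {x y z} → 0ℤ ≤ z → y - (+ 1 + x) ≡ z → x < y
  <-from p e = suc[i]≤j⇒i<j (≤-from p e)

  refute : ∀ {z} → 0ℤ ≤ z → z ≡ -1ℤ → ⊥
  refute p refl with () ← p

  ≤*⇒≤ : ∀ {x y z} → 0ℤ < z → x * z ≤ y * z → x ≤ y
  ≤*⇒≤ {x} {y} {z} 0<z = *-cancelʳ-≤-pos x y z ⦃ positive 0<z ⦄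

  ≤²⇒≤ : ∀ {x y} → 0ℤ ≤ y → x * x ≤ y * y → x ≤ y
  ≤²⇒≤ {x} {y} 0≤y x²≤y² = ≮⇒≥ y≮x
    where
    y≮x : y ≮ x
    y≮x y<x = refute
      (gap x²≤y² ⊕ gap< y<x ⊗ (gap< y<x ⊕ nat 2 ⊗ 0≤y ⊕ nat 2) ⊕ nat 2 ⊗ 0≤y)
      (solve (x ∷ y ∷ []))

  sum-mono : ∀ {n} {f g : Fin n → ℤ} → (∀ i → f i ≤ g i) → sum f ≤ sum g
  sum-mono {ℕ.zero}  h = ≤-refl
  sum-mono {ℕ.suc n} h = +-mono-≤ (h zero) (sum-mono (h ∘ suc))

  sum≥0 : ∀ {n} {f : Fin n → ℤ} → (∀ i → 0ℤ ≤ f i) → 0ℤ ≤ sum f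
  sum≥0 {ℕ.zero}  h = ≤-refl
  sum≥0 {ℕ.suc n} h = h zero ⊕ sum≥0 (h ∘ suc)

  sum-const : ∀ n c → sum {n} (λ _ → c) ≡ + n * c
  sum-const ℕ.zero    c = refl
  sum-const (ℕ.suc n) c = trans (cong (_+_ c) (sum-const n c)) (sym (suc-* (+ n) c))

  sum-*ˡ : ∀ {n} c (f : Fin n → ℤ) → sum (λ i → c * f i) ≡ c * sum f
  sum-*ˡ c f = sym (*-distribˡ-sum c f)

  sum-*ʳ : ∀ {n} (f : Fin n → ℤ) c → sum (λ i → f i * c) ≡ sum f * c
  sum-*ʳ f c = sym (*-distribʳ-sum c f)

  term≤sum : ∀ {n} {f : Fin n → ℤ} → (∀ i → 0ℤ ≤ f i) → ∀ i → f i ≤ sum f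
  term≤sum {ℕ.suc n} {f} h i = ≤-from (sum≥0 (h ∘ punchIn i))
    (trans (cong (_- f i) (sum-remove {i = i} f)) (cancel (f i) (sum (removeAt f i))))
    where
    cancel : ∀ x y → x + y - x ≡ y
    cancel = solve-∀

  two≤sum : ∀ {n} {f : Fin n → ℤ} → (∀ i → 0ℤ ≤ f i) → ∀ {i j} → i ≢ j → f i + f j ≤ sum f
  two≤sum {ℕ.suc n} {f} h {i} {j} i≢j = begin
    f i + f j                                 ≡⟨ cong (λ l → f i + f l) (sym (punchIn-punchOut i≢j)) ⟩
    f i + removeAt f i (punchOut i≢j)         ≤⟨ +-monoʳ-≤ (f i) (term≤sum (h ∘ punchIn i) (punchOut i≢j)) ⟩
    f i + sum (removeAt f i)                  ≡⟨ sym (sum-remove {i = i} f) ⟩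
    sum f                                     ∎
    where open ≤-Reasoning

  three≤sum : ∀ {n} {f : Fin n → ℤ} → (∀ i → 0ℤ ≤ f i) → ∀ {i j l} → i ≢ j → i ≢ l → j ≢ l →
              f i + (f j + f l) ≤ sum f
  three≤sum {ℕ.suc n} {f} h {i} {j} {l} i≢j i≢l j≢l = begin
    f i + (f j + f l)
      ≡⟨ cong₂ (λ u v → f i + (f u + f v)) (sym (punchIn-punchOut i≢j)) (sym (punchIn-punchOut i≢l)) ⟩
    f i + (removeAt f i (punchOut i≢j) + removeAt f i (punchOut i≢l))
      ≤⟨ +-monoʳ-≤ (f i) (two≤sum (h ∘ punchIn i) (j≢l ∘ punchOut-injective i≢j i≢l)) ⟩
    f i + sum (removeAt f i)
      ≡⟨ sym (sum-remove {i = i} f) ⟩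
    sum f ∎
    where open ≤-Reasoning

  sum-squares≤ : ∀ {n} {f : Fin n → ℤ} → (∀ i → 0ℤ ≤ f i) → sum (λ i → f i * f i) ≤ sum f * sum f
  sum-squares≤ {f = f} h = begin
    sum (λ i → f i * f i)    ≤⟨ sum-mono (λ i → ≤-from (h i ⊗ gap (term≤sum h i)) (lem (f i) (sum f))) ⟩
    sum (λ i → f i * sum f)  ≡⟨ sum-*ʳ f (sum f) ⟩
    sum f * sum f            ∎
    where
    open ≤-Reasoning
    lem : ∀ x s → x * s - x * x ≡ x * (s - x)
    lem = solve-∀

  sum-squares-split : ∀ {n} {f : Fin n → ℤ} → (∀ i → 0ℤ ≤ f i) → ∀ i →
                      sum (λ j → f j * f j) ≤ f i * f i + (sum f - f i) * (sum f - f i)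
  sum-squares-split {ℕ.suc n} {f} h i = begin
    sum (λ j → f j * f j)                               ≡⟨ sum-remove {i = i} (λ j → f j * f j) ⟩
    f i * f i + sum (λ j → rest j * rest j)             ≤⟨ +-monoʳ-≤ (f i * f i) (sum-squares≤ (h ∘ punchIn i)) ⟩
    f i * f i + sum rest * sum rest                     ≡⟨ lem (f i) (sum rest) ⟩
    f i * f i + (f i + sum rest - f i) * (f i + sum rest - f i)
      ≡⟨ cong (λ s → f i * f i + (s - f i) * (s - f i)) (sym (sum-remove {i = i} f)) ⟩
    f i * f i + (sum f - f i) * (sum f - f i)           ∎
    where
    open ≤-Reasoning
    rest = removeAt f i
    lem : ∀ x s → x * x + s * s ≡ x * x + (x + s - x) * (x + s - x)
    lem = solve-∀

  -- Polynomial inequalities behind the case of odd k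

  -- Put P = 2b + D; `m` is the weight of the heaviest partner. If 2m ≤ D, then q ≤ mD gives 2ℓ² ≤
  -- P². Otherwise m² + (D - m)² increases with m, and at the limit m = 2ℓ - P density reads (y -
  -- ℓ)(5y + 4b - 7ℓ) > 0 for y = b + D, so that 5P > 7ℓ. Both √2 and 7/5 exceed the 4/3 that is
  -- wanted.
  spread-vertex-large : ∀ ℓ b m D q → 0ℤ < ℓ → 0ℤ ≤ b → 0ℤ ≤ m → m ≤ D →
    ℓ * ℓ ≤ b * b + + 2 * b * D + q → q ≤ m * m + (D - m) * (D - m) → q ≤ m * D → ℓ ≤ b + D →
    + 2 * b + D + m < + 2 * ℓ → + 4 * ℓ ≤ + 3 * (+ 2 * b + D)
  spread-vertex-large ℓ b m D q 0<ℓ 0≤b 0≤m m≤D dense q≤₁ q≤₂ ℓ≤b+D bad =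
    ≮⇒≥ λ lt → [ few-heavy lt , one-heavy lt ]′ (≤-total (+ 2 * m) D)
    where
    few-heavy : + 3 * (+ 2 * b + D) < + 4 * ℓ → + 2 * m ≤ D → ⊥
    few-heavy lt 2m≤D = refute
      (nat 9 ⊗ (nat 2 ⊗ gap dense ⊕ nat 2 ⊗ gap q≤₂ ⊕ (0≤m ⊕ gap m≤D) ⊗ gap 2m≤D ⊕ nat 2 ⊗ sq b)
        ⊕ (gap< lt ⊕ nat 1) ⊗ (nat 4 ⊗ (gap< 0<ℓ ⊕ nat 1) ⊕ nat 3 ⊗ (nat 2 ⊗ 0≤b ⊕ (0≤m ⊕ gap m≤D)))
        ⊕ nat 2 ⊗ sq (ℓ - (+ 1 + 0ℤ)) ⊕ nat 4 ⊗ gap< 0<ℓ ⊕ nat 1)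
      (solve (ℓ ∷ b ∷ m ∷ D ∷ q ∷ []))
    one-heavy : + 3 * (+ 2 * b + D) < + 4 * ℓ → D ≤ + 2 * m → ⊥
    one-heavy lt D≤2m = refute
      (nat 3 ⊗ gap dense ⊕ nat 3 ⊗ gap q≤₁
        ⊕ gap ℓ≤b+D ⊗ (nat 5 ⊗ gap< lt ⊕ nat 5 ⊕ (gap< 0<ℓ ⊕ nat 1) ⊕ nat 3 ⊗ 0≤b)
        ⊕ nat 6 ⊗ (gap< bad ⊗ gap< bad ⊕ nat 2 ⊗ gap< bad ⊕ (gap< bad ⊕ nat 1) ⊗ gap D≤2m)
        ⊕ nat 5)
      (solve (ℓ ∷ b ∷ m ∷ D ∷ q ∷ []))

  -- Serves three colours i, j, l in which each is the heaviest partner of the one before. If mₗ ≤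
  -- mⱼ, the bounds for i and l and the first bound for j telescope. Otherwise averaging the two
  -- bounds for j gives mᵢ / 2, and averaging those for l gives mⱼ / 2.
  good-path-good : ∀ ℓ mᵢ mⱼ mₗ gᵢ gⱼ gₗ → mᵢ ≤ mⱼ →
    ℓ - mᵢ ≤ gᵢ → mᵢ + mⱼ - ℓ ≤ gⱼ → ℓ - mⱼ ≤ gⱼ → ℓ - mₗ ≤ gₗ → mₗ ≤ mⱼ ⊎ mⱼ + mₗ - ℓ ≤ gₗ →
    ℓ ≤ gᵢ + (gⱼ + gₗ)
  good-path-good ℓ mᵢ mⱼ mₗ gᵢ gⱼ gₗ mᵢ≤mⱼ hᵢ hⱼ hⱼ′ hₗ (inj₁ mₗ≤mⱼ) =
    ≤-from (gap hᵢ ⊕ gap hⱼ ⊕ gap hₗ ⊕ gap mₗ≤mⱼ) (solve (ℓ ∷ mᵢ ∷ mⱼ ∷ mₗ ∷ gᵢ ∷ gⱼ ∷ gₗ ∷ []))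
  good-path-good ℓ mᵢ mⱼ mₗ gᵢ gⱼ gₗ mᵢ≤mⱼ hᵢ hⱼ hⱼ′ hₗ (inj₂ hₗ′) =
    *-cancelˡ-≤-pos ℓ _ (+ 2)
      (≤-from (nat 2 ⊗ gap hᵢ ⊕ gap hⱼ ⊕ gap hⱼ′ ⊕ gap hₗ ⊕ gap hₗ′ ⊕ gap mᵢ≤mⱼ)
        (solve (ℓ ∷ mᵢ ∷ mⱼ ∷ mₗ ∷ gᵢ ∷ gⱼ ∷ gₗ ∷ [])))

  -- The same path when l is only known to have excess at least ℓ / 3; the two bounds for j now
  -- enter with weights 2 and 1.
  good-path-bad : ∀ ℓ mᵢ mⱼ gᵢ gⱼ gₗ → mᵢ ≤ mⱼ →
    ℓ - mᵢ ≤ gᵢ → mᵢ + mⱼ - ℓ ≤ gⱼ → ℓ - mⱼ ≤ gⱼ → ℓ ≤ + 3 * gₗ → ℓ ≤ gᵢ + (gⱼ + gₗ)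
  good-path-bad ℓ mᵢ mⱼ gᵢ gⱼ gₗ mᵢ≤mⱼ hᵢ hⱼ hⱼ′ hₗ =
    *-cancelˡ-≤-pos ℓ _ (+ 3)
      (≤-from (nat 3 ⊗ gap hᵢ ⊕ nat 2 ⊗ gap hⱼ ⊕ gap hⱼ′ ⊕ gap hₗ ⊕ gap mᵢ≤mⱼ)
        (solve (ℓ ∷ mᵢ ∷ mⱼ ∷ gᵢ ∷ gⱼ ∷ gₗ ∷ [])))

  -- With r = D - m density reads (ℓ - b - m)(ℓ + b + m) ≤ r(r + 2b). The bounds `good` and `small`
  -- give b + m ≥ 2ℓ / 3, so the second factor is at least 5ℓ / 3.
  matched-deficit : ∀ ℓ b m D q → 0ℤ < ℓ → 0ℤ ≤ b → m ≤ D →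
    ℓ * ℓ ≤ b * b + + 2 * b * D + q → q ≤ m * m + (D - m) * (D - m) →
    + 2 * ℓ ≤ + 2 * b + D + m → + 3 * (+ 2 * b + (D - m)) ≤ + 2 * ℓ →
    + 5 * ℓ * (ℓ - b - m) ≤ + 3 * (D - m) * (D - m + + 2 * b)
  matched-deficit ℓ b m D q 0<ℓ 0≤b m≤D dense q≤ good small = [ loose , tight ]′ (≤-total 0ℤ (ℓ - b - m))
    where
    loose : 0ℤ ≤ ℓ - b - m → + 5 * ℓ * (ℓ - b - m) ≤ + 3 * (D - m) * (D - m + + 2 * b)
    loose 0≤ω = *-cancelˡ-≤-pos _ _ (+ 2)
      (≤-from (nat 6 ⊗ gap dense ⊕ nat 6 ⊗ gap q≤
               ⊕ 0≤ω ⊗ (gap small ⊕ nat 6 ⊗ 0≤b ⊕ nat 3 ⊗ gap good))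
        (solve (ℓ ∷ b ∷ m ∷ D ∷ q ∷ [])))
    tight : ℓ - b - m ≤ 0ℤ → + 5 * ℓ * (ℓ - b - m) ≤ + 3 * (D - m) * (D - m + + 2 * b)
    tight ω≤0 =
      ≤-from (nat 3 ⊗ gap m≤D ⊗ (gap m≤D ⊕ nat 2 ⊗ 0≤b) ⊕ nat 5 ⊗ <⇒≤ 0<ℓ ⊗ gap ω≤0)
        (solve (ℓ ∷ b ∷ m ∷ D ∷ []))

  -- Adding 5ℓ times the first bound to 6 r times the second one eliminates β.
  pair-deficit-ordered : ∀ ℓ β γ r s δ → 0ℤ < ℓ → 0ℤ ≤ γ → 0ℤ ≤ r → r ≤ s → + 3 * s ≤ + 2 * ℓ →
    + 5 * ℓ * (δ + γ) ≤ + 3 * r * (r + + 2 * β) → + 5 * ℓ * (δ + β) ≤ + 3 * s * (s + + 2 * γ) →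
    + 5 * ℓ * δ ≤ + 3 * r * s
  pair-deficit-ordered ℓ β γ r s δ 0<ℓ 0≤γ 0≤r r≤s 3s≤2ℓ h₁ h₂ = ≤*⇒≤ pos-factor
    (≤-from (nat 5 ⊗ 0≤ℓ ⊗ gap h₁ ⊕ nat 6 ⊗ 0≤r ⊗ gap h₂
             ⊕ 0≤γ ⊗ (nat 9 ⊗ 0≤ℓ ⊗ 0≤ℓ ⊕ nat 12 ⊗ (gap 3s≤2ℓ ⊕ nat 3 ⊗ gap r≤s) ⊗ 0≤s ⊕ nat 8 ⊗ 0≤ℓ ⊗ gap 3s≤2ℓ)
             ⊕ nat 3 ⊗ 0≤r ⊗ gap r≤s ⊗ (0≤ℓ ⊕ nat 2 ⊗ gap 3s≤2ℓ))
      (solve (ℓ ∷ β ∷ γ ∷ r ∷ s ∷ δ ∷ [])))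
    where
    0≤ℓ : 0ℤ ≤ ℓ
    0≤ℓ = <⇒≤ 0<ℓ
    0≤s : 0ℤ ≤ s
    0≤s = ≤-trans 0≤r r≤s
    pos-factor : 0ℤ < + 5 * ℓ + + 6 * r
    pos-factor = <-from (nat 5 ⊗ gap< 0<ℓ ⊕ nat 4 ⊕ nat 6 ⊗ 0≤r) (solve (ℓ ∷ r ∷ []))

  -- For a matched pair, β and γ are its values of b, r and s the weights leaving it, and δ = ℓ - β
  -- - γ - m. The two one-sided deficits combine into one that no longer involves β and γ.
  pair-deficit : ∀ ℓ β γ r s δ → 0ℤ < ℓ → 0ℤ ≤ β → 0ℤ ≤ γ → 0ℤ ≤ r → 0ℤ ≤ s →
    + 3 * r ≤ + 2 * ℓ → + 3 * s ≤ + 2 * ℓ →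
    + 5 * ℓ * (δ + γ) ≤ + 3 * r * (r + + 2 * β) → + 5 * ℓ * (δ + β) ≤ + 3 * s * (s + + 2 * γ) →
    + 5 * ℓ * δ ≤ + 3 * r * s
  pair-deficit ℓ β γ r s δ 0<ℓ 0≤β 0≤γ 0≤r 0≤s 3r≤2ℓ 3s≤2ℓ h₁ h₂ with ≤-total r s
  ... | inj₁ r≤s = pair-deficit-ordered ℓ β γ r s δ 0<ℓ 0≤γ 0≤r r≤s 3s≤2ℓ h₁ h₂
  ... | inj₂ s≤r = ≤-trans (pair-deficit-ordered ℓ γ β s r δ 0<ℓ 0≤β 0≤s s≤r 3r≤2ℓ h₂ h₁)
      (≤-reflexive (swap r s))
    where
    swap : ∀ x y → + 3 * y * x ≡ + 3 * x * y
    swap = solve-∀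

  -- With r = D - m and δ = ℓ - b - b′ - m the excess is b - b′ + r - δ. After bounding δ, the split
  -- r r′ - u u′ = (r - u) r′ + u (r′ - u′) leaves at least u - 3uu′ / (5ℓ), up to a term that
  -- changes sign when the two colours are exchanged.
  matched-excess : ∀ ℓ b b′ m D r′ u u′ → 0ℤ < ℓ →
    + 5 * ℓ * (ℓ - b - b′ - m) ≤ + 3 * (D - m) * r′ → u ≤ D - m → u′ ≤ r′ →
    + 3 * (D - m) ≤ + 2 * ℓ → + 3 * r′ ≤ + 2 * ℓ →
    + 5 * ℓ * u - + 3 * (u * u′) + ℓ * (+ 2 * (D - m - u) + + 5 * b - (+ 2 * (r′ - u′) + + 5 * b′))
      ≤ + 5 * ℓ * (+ 2 * b + D - ℓ)
  matched-excess ℓ b b′ m D r′ u u′ 0<ℓ h u≤r u′≤r′ 3r≤2ℓ 3r′≤2ℓ =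
    ≤-from (gap h ⊕ gap u≤r ⊗ (<⇒≤ 0<ℓ ⊕ gap 3r′≤2ℓ) ⊕ gap u′≤r′ ⊗ (gap 3r≤2ℓ ⊕ nat 3 ⊗ gap u≤r))
      (solve (ℓ ∷ b ∷ b′ ∷ m ∷ D ∷ r′ ∷ u ∷ u′ ∷ []))

  -- Put y = b + D and g = 2b + D - ℓ. By density U ≤ y² - ℓ². As D + g = 2y - ℓ, the last
  -- hypothesis and T < ℓ give (y - ℓ)(7ℓ - 3y) < 0. But ℓ ≤ y, and g < ℓ forces y < 2ℓ.
  odd-vertex-contradiction : ∀ ℓ b D q U T → 0ℤ < ℓ → 0ℤ ≤ b → T < ℓ → + 2 * b + D - ℓ ≤ T → ℓ ≤ b + D →
    ℓ * ℓ ≤ b * b + + 2 * b * D + q → U ≤ D * D - q →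
    + 5 * ℓ * D - + 3 * U + + 5 * ℓ * (+ 2 * b + D - ℓ) ≤ + 5 * ℓ * T → ⊥
  odd-vertex-contradiction ℓ b D q U T 0<ℓ 0≤b T<ℓ g≤T ℓ≤y dense U≤ h = refute
    (gap h ⊕ nat 3 ⊗ gap U≤ ⊕ nat 3 ⊗ gap dense ⊕ nat 5 ⊗ <⇒≤ 0<ℓ ⊗ gap< T<ℓ
     ⊕ gap ℓ≤y ⊗ (nat 3 ⊗ (gap< T<ℓ ⊕ gap g≤T ⊕ 0≤b) ⊕ <⇒≤ 0<ℓ ⊕ nat 3)
     ⊕ nat 5 ⊗ gap< 0<ℓ ⊕ nat 4)
    (solve (ℓ ∷ b ∷ D ∷ q ∷ U ∷ T ∷ []))

  -- Involutions

  indicator : ∀ {a} {P : Set a} → Dec P → ℤ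
  indicator (yes _) = + 1
  indicator (no _)  = + 0

  indicator-yes : ∀ {a} {P : Set a} (P? : Dec P) → P → indicator P? ≡ + 1
  indicator-yes (yes _) _ = refl
  indicator-yes (no ¬p) p = ⊥-elim (¬p p)

  indicator-no : ∀ {a} {P : Set a} (P? : Dec P) → ¬ P → indicator P? ≡ + 0
  indicator-no (yes p) ¬p = ⊥-elim (¬p p)
  indicator-no (no _)  _  = refl

  indicator≥0 : ∀ {a} {P : Set a} (P? : Dec P) → 0ℤ ≤ indicator P?
  indicator≥0 (yes _) = nat 1
  indicator≥0 (no _)  = nat 0

  indicator-⇔ : ∀ {a b} {P : Set a} {Q : Set b} (P? : Dec P) (Q? : Dec Q) → (P → Q) → (Q → P) →
                indicator P? ≡ indicator Q?
  indicator-⇔ (yes p) Q? f g = sym (indicator-yes Q? (f p))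
  indicator-⇔ (no ¬p) Q? f g = sym (indicator-no Q? (¬p ∘ g))

  sum-minus : ∀ {n} (f g : Fin n → ℤ) → sum (λ i → f i - g i) ≡ sum f - sum g
  sum-minus {ℕ.zero}  f g = refl
  sum-minus {ℕ.suc n} f g = trans (cong (_+_ (f zero - g zero)) (sum-minus (f ∘ suc) (g ∘ suc)))
    (lem (f zero) (g zero) (sum (f ∘ suc)) (sum (g ∘ suc)))
    where
    lem : ∀ x y s t → x - y + (s - t) ≡ x + s - (y + t)
    lem = solve-∀

  sum-involution : ∀ {n} (σ : Fin n → Fin n) → (∀ i → σ (σ i) ≡ i) → (f : Fin n → ℤ) → sum f ≡ sum (f ∘ σ)
  sum-involution σ inv f = sum-permute f (permutation σ σ inv inv)

  argmax : ∀ {n} → Fin n → (f : Fin n → ℤ) → ∃[ p ] (∀ j → f j ≤ f p)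
  argmax {ℕ.suc ℕ.zero}    _ f = zero , λ { zero → ≤-refl }
  argmax {ℕ.suc (ℕ.suc n)} _ f with argmax zero (f ∘ suc)
  ... | p , f≤fp with ≤-total (f zero) (f (suc p))
  ...   | inj₁ f0≤fp = suc p , λ { zero → f0≤fp ; (suc j) → f≤fp j }
  ...   | inj₂ fp≤f0 = zero  , λ { zero → ≤-refl ; (suc j) → ≤-trans (f≤fp j) fp≤f0 }

  module _ {n} (σ : Fin n → Fin n) (inv : ∀ i → σ (σ i) ≡ i) where

    fixedPoint# : ℤ
    fixedPoint# = sum (λ i → indicator (σ i ≟ i))

    -- The points moved up and those moved down are exchanged by σ, so they are equally many.
    fixedPoint#-parity : ∃[ h ] + n ≡ fixedPoint# + + 2 * h
    fixedPoint#-parity = sum up , (begin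
      + n                                     ≡⟨ sym (trans (sum-const n (+ 1)) (*-identityʳ (+ n))) ⟩
      sum {n} (λ _ → + 1)                     ≡⟨ sum-cong-≗ trichotomy ⟩
      sum (λ i → fix i + (up i + down i))     ≡⟨ ∑-distrib-+ fix (λ i → up i + down i) ⟩
      sum fix + sum (λ i → up i + down i)     ≡⟨ cong (_+_ (sum fix)) (∑-distrib-+ up down) ⟩
      sum fix + (sum up + sum down)           ≡⟨ cong (λ s → sum fix + (sum up + s)) (sym up≡down) ⟩
      sum fix + (sum up + sum up)             ≡⟨ lem (sum fix) (sum up) ⟩
      sum fix + + 2 * sum up                  ∎)
      where
      open ≡-Reasoning
      fix up down : Fin n → ℤ
      fix i  = indicator (σ i ≟ i)
      up i   = indicator (i Fin.<? σ i)
      down i = indicator (σ i Fin.<? i)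
      trichotomy : ∀ i → + 1 ≡ fix i + (up i + down i)
      trichotomy i with <-cmp i (σ i)
      ... | tri< a b c
        rewrite indicator-no (σ i ≟ i) (b ∘ sym) | indicator-yes (i Fin.<? σ i) a | indicator-no (σ i Fin.<? i) c = refl
      ... | tri≈ a b c
        rewrite indicator-yes (σ i ≟ i) (sym b) | indicator-no (i Fin.<? σ i) a | indicator-no (σ i Fin.<? i) c = refl
      ... | tri> a b c
        rewrite indicator-no (σ i ≟ i) (b ∘ sym) | indicator-no (i Fin.<? σ i) a | indicator-yes (σ i Fin.<? i) c = refl
      up≡down : sum up ≡ sum down
      up≡down = trans (sum-involution σ inv up) (sum-cong-≗ λ i →
        indicator-⇔ (σ i Fin.<? σ (σ i)) (σ i Fin.<? i) (subst (σ i Fin.<_) (inv i)) (subst (σ i Fin.<_) (sym (inv i))))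
      lem : ∀ x y → x + (y + y) ≡ x + + 2 * y
      lem = solve-∀

    unique-fixed-point : fixedPoint# ≡ + 1 → ∃[ x ] σ x ≡ x × (∀ l → l ≢ x → σ l ≢ l)
    unique-fixed-point F≡1 with any? (λ i → σ i ≟ i)
    ... | no none with () ← trans (sym F≡1) (trans (sum-cong-≗ λ i → indicator-no (σ i ≟ i) (λ e → none (i , e)))
                                              (trans (sum-const n (+ 0)) (*-zeroʳ (+ n))))
    ... | yes (x , σx≡x) = x , σx≡x , λ l l≢x σl≡l → 2≰1 (subst₂ _≤_
            (cong₂ _+_ (indicator-yes (σ l ≟ l) σl≡l) (indicator-yes (σ x ≟ x) σx≡x)) F≡1
            (two≤sum (λ i → indicator≥0 (σ i ≟ i)) l≢x))
      where
      2≰1 : ¬ + 2 ≤ + 1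
      2≰1 (+≤+ (ℕ.s≤s ()))

  odd<3⇒≡1 : ∀ {n F h h′} → n ≡ F + + 2 * h′ → n ≡ + 1 + + 2 * h → 0ℤ ≤ F → F < + 3 → F ≡ + 1
  odd<3⇒≡1 {n} {F} {h} {h′} n≡ n-odd 0≤F F<3 =
    trans F≡ (cong (λ z → + 1 + + 2 * z) (≤-antisym (≮⇒≥ (upper (h - h′) (subst (_< + 3) F≡ F<3)))
                                                     (≮⇒≥ (lower (h - h′) (subst (0ℤ ≤_) F≡ 0≤F)))))
    where
    shift : ∀ x z → x ≡ x + + 2 * z - + 2 * z
    shift = solve-∀
    unshift : ∀ y z → + 1 + + 2 * y - + 2 * z ≡ + 1 + + 2 * (y - z)
    unshift = solve-∀
    F≡ : F ≡ + 1 + + 2 * (h - h′)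
    F≡ = trans (shift F h′) (trans (cong (_- + 2 * h′) (trans (sym n≡) n-odd)) (unshift h h′))
    lower : ∀ e → 0ℤ ≤ + 1 + + 2 * e → ¬ e < 0ℤ
    lower e h₁ h₂ = refute (h₁ ⊕ nat 2 ⊗ gap< h₂) (solve (e ∷ []))
    upper : ∀ e → + 1 + + 2 * e < + 3 → ¬ 0ℤ < e
    upper e h₁ h₂ = refute (gap< h₁ ⊕ nat 2 ⊗ gap< h₂) (solve (e ∷ []))

  -- Odd numbers of colours, a = 0

  module Core {k : ℕ} (b : Fin k → ℤ) (d : Fin k → Fin k → ℤ) (ℓ : ℤ)
    (0<ℓ : 0ℤ < ℓ) (b≥0 : ∀ i → 0ℤ ≤ b i) (d≥0 : ∀ i j → 0ℤ ≤ d i j)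
    (d-sym : ∀ i j → d i j ≡ d j i) (d-irrefl : ∀ i → d i i ≡ 0ℤ)
    (dense : ∀ i → ℓ * ℓ ≤ b i * b i + + 2 * b i * sum (d i) + sum (λ j → d i j * d i j))
    (light : sum (λ i → + 2 * b i + sum (d i) - ℓ) < ℓ)
    where

    D m g q : Fin k → ℤ
    D i = sum (d i)
    q i = sum (λ j → d i j * d i j)
    g i = + 2 * b i + D i - ℓ

    π : Fin k → Fin k
    π i = proj₁ (argmax i (d i))

    m i = d i (π i)

    d≤m : ∀ i j → d i j ≤ m i
    d≤m i = proj₂ (argmax i (d i))

    m≥0 : ∀ i → 0ℤ ≤ m i
    m≥0 i = d≥0 i (π i)

    m≤D : ∀ i → m i ≤ D i
    m≤D i = term≤sum (d≥0 i) (π i)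

    D≥0 : ∀ i → 0ℤ ≤ D i
    D≥0 i = sum≥0 (d≥0 i)

    ℓ≤b+D : ∀ i → ℓ ≤ b i + D i
    ℓ≤b+D i = ≤²⇒≤ (b≥0 i ⊕ D≥0 i)
      (≤-trans (dense i) (expand (b i) (D i) (q i) (sum-squares≤ (d≥0 i))))
      where
      expand : ∀ x y z → z ≤ y * y → x * x + + 2 * x * y + z ≤ (x + y) * (x + y)
      expand x y z h = ≤-from (gap h) (solve (x ∷ y ∷ z ∷ []))

    g≥0 : ∀ i → 0ℤ ≤ g i
    g≥0 i = lem (b i) (D i) ℓ (b≥0 i) (ℓ≤b+D i)
      where
      lem : ∀ x y l → 0ℤ ≤ x → l ≤ x + y → 0ℤ ≤ + 2 * x + y - l
      lem x y l 0≤x h = ≤-from (0≤x ⊕ gap h) (solve (x ∷ y ∷ l ∷ []))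

    g<ℓ : ∀ i → g i < ℓ
    g<ℓ i = ≤-<-trans (term≤sum g≥0 i) light

    m-increases : ∀ i → m i ≤ m (π i)
    m-increases i = subst (_≤ m (π i)) (d-sym (π i) i) (d≤m (π i) i)

    -- This is ℓ ≤ g i + m i: a small excess forces a partner of weight close to ℓ.
    Good : Fin k → Set
    Good i = + 2 * ℓ ≤ + 2 * b i + D i + m i

    good? : ∀ i → Dec (Good i)
    good? i = _ ≤? _

    bad⇒large : ∀ i → ¬ Good i → ℓ ≤ + 3 * g i
    bad⇒large i bad = lem (b i) (D i) ℓ
      (spread-vertex-large ℓ (b i) (m i) (D i) (q i) 0<ℓ (b≥0 i) (m≥0 i) (m≤D i) (dense i)
        (sum-squares-split (d≥0 i) (π i)) q≤mD (ℓ≤b+D i) (≰⇒> bad))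
      where
      lem : ∀ x y l → + 4 * l ≤ + 3 * (+ 2 * x + y) → l ≤ + 3 * (+ 2 * x + y - l)
      lem x y l h = ≤-from (gap h) (solve (x ∷ y ∷ l ∷ []))
      row : ∀ x y → 0ℤ ≤ x → x ≤ y → x * x ≤ y * x
      row x y 0≤x h = ≤-from (0≤x ⊗ gap h) (solve (x ∷ y ∷ []))
      q≤mD : q i ≤ m i * D i
      q≤mD = ≤-trans (sum-mono (λ j → row (d i j) (m i) (d≥0 i j) (d≤m i j)))
                     (≤-reflexive (sum-*ˡ (m i) (d i)))

    good⇒ℓ-m≤g : ∀ i → Good i → ℓ - m i ≤ g i
    good⇒ℓ-m≤g i = lem (b i) (D i) (m i) ℓ
      where
      lem : ∀ x y z l → + 2 * l ≤ + 2 * x + y + z → l - z ≤ + 2 * x + y - l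
      lem x y z l h = ≤-from (gap h) (solve (x ∷ y ∷ z ∷ l ∷ []))

    -- The maximum of a row may be found on the diagonal, but then it is 0 and goodness gives g i ≥
    -- ℓ.
    good⇒π≢ : ∀ i → Good i → π i ≢ i
    good⇒π≢ i good πi≡i = <⇒≱ (g<ℓ i) (subst (_≤ g i) ℓ-m≡ℓ (good⇒ℓ-m≤g i good))
      where
      ℓ-m≡ℓ : ℓ - m i ≡ ℓ
      ℓ-m≡ℓ = trans (cong (λ z → ℓ - z) (trans (cong (d i) πi≡i) (d-irrefl i))) (+-identityʳ ℓ)

    two-edges : ∀ i {j l} → j ≢ l → d i j + d i l - ℓ ≤ g i
    two-edges i {j} {l} j≢l = lem (b i) (D i) (d i j) (d i l) ℓ (b≥0 i) (two≤sum (d≥0 i) j≢l)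
      where
      lem : ∀ x y u v w → 0ℤ ≤ x → u + v ≤ y → u + v - w ≤ + 2 * x + y - w
      lem x y u v w 0≤x h = ≤-from (nat 2 ⊗ 0≤x ⊕ gap h) (solve (x ∷ y ∷ u ∷ v ∷ w ∷ []))

    three-light : ∀ {i j l} → i ≢ j → i ≢ l → j ≢ l → g i + (g j + g l) < ℓ
    three-light i≢j i≢l j≢l = ≤-<-trans (three≤sum g≥0 i≢j i≢l j≢l) light

    Matched : Fin k → Set
    Matched i = Good i × Good (π i)

    matched? : ∀ i → Dec (Matched i)
    matched? i = good? i ×-dec good? (π i)

    -- Otherwise i, `π i` and `π (π i)` are three different colours whose excesses already add up to
    -- ℓ.
    matched⇒mutual : ∀ i → Matched i → π (π i) ≡ i
    matched⇒mutual i (good-i , good-j) with π (π i) ≟ i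
    ... | yes e = e
    ... | no l≢i = ⊥-elim (<⇒≱ (three-light i≢j (l≢i ∘ sym) j≢l) heavy)
      where
      j l : Fin k
      j = π i
      l = π j
      i≢j : i ≢ j
      i≢j = good⇒π≢ i good-i ∘ sym
      j≢l : j ≢ l
      j≢l = good⇒π≢ j good-j ∘ sym
      gⱼ-large : m i + m j - ℓ ≤ g j
      gⱼ-large = subst (λ z → z + m j - ℓ ≤ g j) (d-sym j i) (two-edges j (l≢i ∘ sym))
      heavy : ℓ ≤ g i + (g j + g l)
      heavy with good? l
      ... | no bad-l = good-path-bad ℓ (m i) (m j) (g i) (g j) (g l) (m-increases i)
                         (good⇒ℓ-m≤g i good-i) gⱼ-large (good⇒ℓ-m≤g j good-j) (bad⇒large l bad-l)
      ... | yes good-l = good-path-good ℓ (m i) (m j) (m l) (g i) (g j) (g l) (m-increases i)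
                           (good⇒ℓ-m≤g i good-i) gⱼ-large (good⇒ℓ-m≤g j good-j) (good⇒ℓ-m≤g l good-l) last
        where
        last : m l ≤ m j ⊎ m j + m l - ℓ ≤ g l
        -- Either j is the heaviest partner of l and m l = m j, or row l contains the two separate
        -- entries d l j = m j and m l.
        last with π l ≟ j
        ... | yes πl≡j = inj₁ (≤-reflexive (trans (cong (d l) πl≡j) (d-sym l j)))
        ... | no  πl≢j = inj₂ (subst (λ z → z + m l - ℓ ≤ g l) (d-sym l j) (two-edges l (πl≢j ∘ sym)))

    matched-π : ∀ i → Matched i → Matched (π i)
    matched-π i mt@(good-i , good-j) = good-j , subst Good (sym (matched⇒mutual i mt)) good-i

    -- If i is good and j = `π i` is bad, then g j ≥ ℓ / 3 and g j + m j < ℓ, hence m i ≤ m j < 2ℓ /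
    -- 3 and g i ≥ ℓ - m i > ℓ / 3.
    unmatched⇒large : ∀ i → ¬ Matched i → ℓ ≤ + 3 * g i
    unmatched⇒large i ¬mt with good? i
    ... | no bad-i   = bad⇒large i bad-i
    ... | yes good-i = lem (b j) (D j) (m i) (m j) ℓ (g i) (bad⇒large j bad-j) (≰⇒> bad-j) (m-increases i)
                         (good⇒ℓ-m≤g i good-i)
      where
      j : Fin k
      j = π i
      bad-j : ¬ Good j
      bad-j good-j = ¬mt (good-i , good-j)
      lem : ∀ x y u v w z → w ≤ + 3 * (+ 2 * x + y - w) → + 2 * x + y + v < + 2 * w → u ≤ v → w - u ≤ z →
            w ≤ + 3 * z
      lem x y u v w z h₁ h₂ h₃ h₄ = ≤-from (gap h₁ ⊕ nat 3 ⊗ gap< h₂ ⊕ nat 3 ⊗ gap h₃ ⊕ nat 3 ⊗ gap h₄ ⊕ nat 3)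
        (solve (x ∷ y ∷ u ∷ v ∷ w ∷ z ∷ []))

    -- The involution exchanging matched colours

    σ : Fin k → Fin k
    σ i with matched? i
    ... | yes _ = π i
    ... | no  _ = i

    σ-matched : ∀ i → Matched i → σ i ≡ π i
    σ-matched i mt with matched? i
    ... | yes _  = refl
    ... | no ¬mt = ⊥-elim (¬mt mt)

    σ-unmatched : ∀ i → ¬ Matched i → σ i ≡ i
    σ-unmatched i ¬mt with matched? i
    ... | yes mt = ⊥-elim (¬mt mt)
    ... | no _   = refl

    σ-involutive : ∀ i → σ (σ i) ≡ i
    σ-involutive i with matched? i
    ... | yes mt = trans (σ-matched (π i) (matched-π i mt)) (matched⇒mutual i mt)
    ... | no ¬mt = σ-unmatched i ¬mt

    fixed⇒unmatched : ∀ i → σ i ≡ i → ¬ Matched i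
    fixed⇒unmatched i σi≡i mt = good⇒π≢ i (proj₁ mt) (trans (sym (σ-matched i mt)) σi≡i)

    nonfixed⇒matched : ∀ i → σ i ≢ i → Matched i
    nonfixed⇒matched i σi≢i with matched? i
    ... | yes mt = mt
    ... | no  _  = ⊥-elim (σi≢i refl)

    -- Each fixed point is unmatched and takes a third of ℓ out of a total excess below ℓ.
    fixedPoint#≤2 : fixedPoint# σ σ-involutive < + 3
    fixedPoint#≤2 = lem ℓ (fixedPoint# σ σ-involutive) (sum g) 0<ℓ light (begin
      ℓ * sum fix                 ≡⟨ sym (sum-*ˡ ℓ fix) ⟩
      sum (λ i → ℓ * fix i)       ≤⟨ sum-mono fix≤ ⟩
      sum (λ i → + 3 * g i)       ≡⟨ sum-*ˡ (+ 3) g ⟩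
      + 3 * sum g                 ∎)
      where
      open ≤-Reasoning
      fix : Fin k → ℤ
      fix i = indicator (σ i ≟ i)
      fix≤ : ∀ i → ℓ * fix i ≤ + 3 * g i
      fix≤ i with σ i ≟ i
      ... | yes e = subst (_≤ + 3 * g i) (sym (*-identityʳ ℓ)) (unmatched⇒large i (fixed⇒unmatched i e))
      ... | no  _ = subst (_≤ + 3 * g i) (sym (*-zeroʳ ℓ)) (nat 3 ⊗ g≥0 i)
      lem : ∀ l x t → 0ℤ < l → t < l → l * x ≤ + 3 * t → x < + 3
      lem l x t 0<l t<l h = ≰⇒> 3≰x
        where
        3≰x : ¬ + 3 ≤ x
        3≰x 3≤x = refute (gap h ⊕ nat 3 ⊗ gap< t<l ⊕ <⇒≤ 0<l ⊗ gap 3≤x ⊕ nat 2) (solve (l ∷ x ∷ t ∷ []))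

    m-matched : ∀ i → Matched i → m (π i) ≡ m i
    m-matched i mt = trans (cong (d (π i)) (matched⇒mutual i mt)) (d-sym (π i) i)

    -- Charging the excesses to the single unmatched colour

    module OddVertex (x : Fin k) (σx≡x : σ x ≡ x) (others : ∀ l → l ≢ x → σ l ≢ l) where

      x-unmatched : ¬ Matched x
      x-unmatched = fixed⇒unmatched x σx≡x

      others-matched : ∀ l → l ≢ x → Matched l
      others-matched l l≢x = nonfixed⇒matched l (others l l≢x)

      π≢x : ∀ l → Matched l → π l ≢ x
      π≢x l mt πl≡x = x-unmatched (subst Matched πl≡x (matched-π l mt))

      -- For l ≠ x, `r l` is the weight leaving the pair of l and `u l` the part of it that goes to
      -- x. The charge `φ l` is to be paid by 5ℓ g l; its last summand vanishes in the sum over l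
      -- because σ is an involution.
      u r F φ : Fin k → ℤ
      u l = d x l
      r l = D l - m l
      F l = + 2 * (r l - u l) + + 5 * b l
      φ l = + 5 * ℓ * u l - + 3 * (u l * u (σ l)) + ℓ * (F l - F (σ l))

      r≥0 : ∀ l → 0ℤ ≤ r l
      r≥0 l = gap (m≤D l)

      ux≡0 : u x ≡ 0ℤ
      ux≡0 = d-irrefl x

      φx≡0 : φ x ≡ 0ℤ
      φx≡0 = trans (cong₂ (λ w f → + 5 * ℓ * w - + 3 * (w * u (σ x)) + ℓ * (F x - f)) ux≡0 (cong F σx≡x))
                   (lem ℓ (u (σ x)) (F x))
        where
        lem : ∀ l w f → + 5 * l * + 0 - + 3 * (+ 0 * w) + l * (f - f) ≡ + 0
        lem = solve-∀

      module _ (l : Fin k) (mt : Matched l) where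

        -- The colours l, `π l` and x are distinct, so their excesses add up to less than ℓ. Of this
        -- `π l` takes at least ℓ - m l, and x takes at least ℓ / 3.
        budget : + 3 * (+ 2 * b l + r l) ≤ + 2 * ℓ
        budget = lem (b l) (D l) (m l) ℓ (g (π l)) (g x)
          (subst (λ z → ℓ - z ≤ g (π l)) (m-matched l mt) (good⇒ℓ-m≤g (π l) (proj₂ mt)))
          (unmatched⇒large x x-unmatched)
          (three-light (good⇒π≢ l (proj₁ mt) ∘ sym) l≢x (π≢x l mt))
          where
          l≢x : l ≢ x
          l≢x refl = x-unmatched mt
          lem : ∀ x y z w s t → w - z ≤ s → w ≤ + 3 * t → + 2 * x + y - w + (s + t) < w →
                + 3 * (+ 2 * x + (y - z)) ≤ + 2 * w
          lem x y z w s t h₁ h₂ h₃ = ≤-from (nat 3 ⊗ gap h₁ ⊕ gap h₂ ⊕ nat 3 ⊗ gap< h₃ ⊕ nat 3)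
            (solve (x ∷ y ∷ z ∷ w ∷ s ∷ t ∷ []))

        3r≤2ℓ : + 3 * r l ≤ + 2 * ℓ
        3r≤2ℓ = lem (b l) (r l) ℓ (b≥0 l) budget
          where
          lem : ∀ x y w → 0ℤ ≤ x → + 3 * (+ 2 * x + y) ≤ + 2 * w → + 3 * y ≤ + 2 * w
          lem x y w 0≤x h = ≤-from (gap h ⊕ nat 6 ⊗ 0≤x) (solve (x ∷ y ∷ w ∷ []))

        deficit : + 5 * ℓ * (ℓ - b l - m l) ≤ + 3 * r l * (r l + + 2 * b l)
        deficit = matched-deficit ℓ (b l) (m l) (D l) (q l) 0<ℓ (b≥0 l) (m≤D l) (dense l)
          (sum-squares-split (d≥0 l) (π l)) (proj₁ mt) budget

        u≤r : u l ≤ r l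
        u≤r = lem (u l) (m l) (D l)
          (subst (λ z → z + m l ≤ D l) (d-sym l x) (two≤sum (d≥0 l) (π≢x l mt ∘ sym)))
          where
          lem : ∀ x y z → x + y ≤ z → x ≤ z - y
          lem x y z h = ≤-from (gap h) (solve (x ∷ y ∷ z ∷ []))

      φ≤matched : ∀ l → Matched l → φ l ≤ + 5 * ℓ * g l
      φ≤matched l mt = subst (λ j → + 5 * ℓ * u l - + 3 * (u l * u j) + ℓ * (F l - F j) ≤ + 5 * ℓ * g l)
        (sym (σ-matched l mt))
        (matched-excess ℓ (b l) (b l′) (m l) (D l) (r l′) (u l) (u l′) 0<ℓ
          -- Both colours satisfy `deficit`; since m (π l) = m l, the two instances concern the same
          -- pair deficit.
          (pair-deficit ℓ (b l) (b l′) (r l) (r l′) (ℓ - b l - b l′ - m l) 0<ℓ (b≥0 l) (b≥0 l′) (r≥0 l) (r≥0 l′)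
            (3r≤2ℓ l mt) (3r≤2ℓ l′ mt′)
            (≤-trans (≤-reflexive (lem₁ ℓ (b l) (b l′) (m l))) (deficit l mt))
            (≤-trans (≤-reflexive (trans (lem₂ ℓ (b l) (b l′) (m l))
                                    (cong (λ z → + 5 * ℓ * (ℓ - b l′ - z)) (sym (m-matched l mt)))))
                     (deficit l′ mt′)))
          (u≤r l mt) (u≤r l′ mt′) (3r≤2ℓ l mt) (3r≤2ℓ l′ mt′))
        where
        l′ : Fin k
        l′ = π l
        mt′ : Matched l′
        mt′ = matched-π l mt
        lem₁ : ∀ l x y z → + 5 * l * (l - x - y - z + y) ≡ + 5 * l * (l - x - z)
        lem₁ = solve-∀
        lem₂ : ∀ l x y z → + 5 * l * (l - x - y - z + x) ≡ + 5 * l * (l - y - z)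
        lem₂ = solve-∀

      surplus : Fin k → ℤ
      surplus l = + 5 * ℓ * g l - φ l

      surplus≥0 : ∀ l → 0ℤ ≤ surplus l
      surplus≥0 l with l ≟ x
      ... | no l≢x   = gap (φ≤matched l (others-matched l l≢x))
      ... | yes refl = subst (λ z → 0ℤ ≤ + 5 * ℓ * g x - z) (sym φx≡0)
                         (subst (0ℤ ≤_) (sym (+-identityʳ (+ 5 * ℓ * g x))) (nat 5 ⊗ <⇒≤ 0<ℓ ⊗ g≥0 x))

      U : ℤ
      U = sum (λ l → u l * u (σ l))

      sum-φ : sum φ ≡ + 5 * ℓ * D x - + 3 * U
      sum-φ = begin
        sum φ ≡⟨ ∑-distrib-+ (λ l → + 5 * ℓ * u l - + 3 * (u l * u (σ l))) (λ l → ℓ * (F l - F (σ l))) ⟩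
        sum (λ l → + 5 * ℓ * u l - + 3 * (u l * u (σ l))) + sum (λ l → ℓ * (F l - F (σ l)))
          ≡⟨ cong₂ _+_ (trans (sum-minus (λ l → + 5 * ℓ * u l) (λ l → + 3 * (u l * u (σ l))))
                              (cong₂ _-_ (sum-*ˡ (+ 5 * ℓ) u) (sum-*ˡ (+ 3) (λ l → u l * u (σ l)))))
                       (trans (sum-*ˡ ℓ (λ l → F l - F (σ l))) (cong (ℓ *_) F-cancels)) ⟩
        + 5 * ℓ * D x - + 3 * U + ℓ * 0ℤ
          ≡⟨ trans (cong (_+_ (+ 5 * ℓ * D x - + 3 * U)) (*-zeroʳ ℓ)) (+-identityʳ _) ⟩
        + 5 * ℓ * D x - + 3 * U ∎
        where
        open ≡-Reasoning
        F-cancels : sum (λ l → F l - F (σ l)) ≡ 0ℤ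
        F-cancels = trans (sum-minus F (F ∘ σ))
          (trans (cong (λ s → sum F - s) (sym (sum-involution σ σ-involutive F))) (+-inverseʳ (sum F)))

      -- For l ≠ x the entries u l and u (σ l) stand in different columns of row x, so u l (u l + u
      -- (σ l)) ≤ u l · D x. For l = x both sides vanish.
      U≤ : U ≤ D x * D x - q x
      U≤ = lem (q x) U (D x * D x) (begin
        q x + U                                      ≡⟨ sym (∑-distrib-+ (λ l → u l * u l) (λ l → u l * u (σ l))) ⟩
        sum (λ l → u l * u l + u l * u (σ l))        ≤⟨ sum-mono row ⟩
        sum (λ l → u l * D x)                        ≡⟨ sum-*ʳ u (D x) ⟩
        D x * D x                                    ∎)
        where
        open ≤-Reasoning
        lem : ∀ x y z → x + y ≤ z → y ≤ z - x
        lem x y z h = ≤-from (gap h) (solve (x ∷ y ∷ z ∷ []))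
        scale : ∀ x y z → 0ℤ ≤ x → x + y ≤ z → x * x + x * y ≤ x * z
        scale x y z 0≤x h = ≤-from (0≤x ⊗ gap h) (solve (x ∷ y ∷ z ∷ []))
        row : ∀ l → u l * u l + u l * u (σ l) ≤ u l * D x
        row l with l ≟ x
        ... | no l≢x = scale (u l) (u (σ l)) (D x) (d≥0 x l) (two≤sum (d≥0 x) (others l l≢x ∘ sym))
        ... | yes refl rewrite ux≡0 = ≤-refl

      contradiction : ⊥
      contradiction = odd-vertex-contradiction ℓ (b x) (D x) (q x) U (sum g) 0<ℓ (b≥0 x) light (term≤sum g≥0 x)
        (ℓ≤b+D x) (dense x) U≤
        -- The colour x pays no charge, so its surplus is all of 5ℓ g x. It is at most the sum of
        -- all surpluses, each being nonnegative.
        (lem (+ 5 * ℓ * g x) (+ 5 * ℓ * D x - + 3 * U) (+ 5 * ℓ * sum g) (begin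
          + 5 * ℓ * g x                                   ≡⟨ sym (trans (cong (λ z → + 5 * ℓ * g x - z) φx≡0)
                                                                   (+-identityʳ (+ 5 * ℓ * g x))) ⟩
          surplus x                                       ≤⟨ term≤sum surplus≥0 x ⟩
          sum surplus                                     ≡⟨ sum-minus (λ l → + 5 * ℓ * g l) φ ⟩
          sum (λ l → + 5 * ℓ * g l) - sum φ               ≡⟨ cong₂ _-_ (sum-*ˡ (+ 5 * ℓ) g) sum-φ ⟩
          + 5 * ℓ * sum g - (+ 5 * ℓ * D x - + 3 * U)     ∎))
        where
        open ≤-Reasoning
        lem : ∀ x y z → x ≤ z - y → y + x ≤ z
        lem x y z h = ≤-from (gap h) (solve (x ∷ y ∷ z ∷ []))

    odd-impossible : ∀ h → + k ≡ + 1 + + 2 * h → ⊥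
    odd-impossible h k-odd = OddVertex.contradiction (proj₁ fixed) (proj₁ (proj₂ fixed)) (proj₂ (proj₂ fixed))
      where
      fixed = unique-fixed-point σ σ-involutive
        (odd<3⇒≡1 {h = h} (proj₂ (fixedPoint#-parity σ σ-involutive)) k-odd
          (sum≥0 (λ i → indicator≥0 (σ i ≟ i))) fixedPoint#≤2)

  -- Weight systems

  *-pos : ∀ u v → 0ℤ < u → 0ℤ < v → 0ℤ < u * v
  *-pos u v 0<u 0<v = <-from (gap< 0<u ⊗ gap< 0<v ⊕ gap< 0<u ⊕ gap< 0<v) (solve (u ∷ v ∷ []))

  -- Keeps the rationals b i / y i inside ℤ, as fractions c i / Y.
  common-denominator : ∀ {n} (y b : Fin n → ℤ) → (∀ i → 0ℤ < y i) →
    ∃[ Y ] Σ[ c ∈ (Fin n → ℤ) ] 0ℤ < Y × (∀ i → c i * y i ≡ Y * b i)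
  common-denominator {ℕ.zero}  y b 0<y = + 1 , (λ ()) , +<+ (ℕ.s≤s ℕ.z≤n) , λ ()
  common-denominator {ℕ.suc n} y b 0<y with common-denominator (y ∘ suc) (b ∘ suc) (0<y ∘ suc)
  ... | Y , c , 0<Y , c*y≡ = y zero * Y , c′ , 0<product , c′*y≡
    where
    c′ : Fin (ℕ.suc n) → ℤ
    c′ zero    = Y * b zero
    c′ (suc i) = y zero * c i
    0<product : 0ℤ < y zero * Y
    0<product = *-pos (y zero) Y (0<y zero) 0<Y
    rotate : ∀ u v w → u * v * w ≡ w * u * v
    rotate = solve-∀
    c′*y≡ : ∀ i → c′ i * y i ≡ y zero * Y * b i
    c′*y≡ zero    = rotate Y (b zero) (y zero)
    c′*y≡ (suc i) = trans (*-assoc (y zero) (c i) (y (suc i)))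
      (trans (cong (y zero *_) (c*y≡ i)) (sym (*-assoc (y zero) Y (b (suc i)))))

  ≤-or-> : ∀ x y → x ≤ y ⊎ y < x
  ≤-or-> x y with x ≤? y
  ... | yes h = inj₁ h
  ... | no  h = inj₂ (≰⇒> h)

  dense⇒P>0 : ∀ b D a q M → 0ℤ ≤ b → 0ℤ ≤ D → 0ℤ ≤ a → M ≤ b * b + + 2 * b * (a + D) + q → q ≤ D * D →
    0ℤ < M → 0ℤ < + 2 * b + D
  dense⇒P>0 b D a q M 0≤b 0≤D 0≤a M≤ q≤D² 0<M = ≰⇒> P≰0
    where
    P≰0 : ¬ + 2 * b + D ≤ 0ℤ
    P≰0 P≤0 = refute
      (gap< 0<M ⊕ gap M≤ ⊕ gap q≤D² ⊕ gap P≤0 ⊗ (nat 2 ⊗ 0≤b ⊕ 0≤D ⊕ 0≤a)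
       ⊕ nat 3 ⊗ sq b ⊕ nat 2 ⊗ 0≤b ⊗ 0≤D ⊕ 0≤a ⊗ 0≤D)
      (solve (b ∷ D ∷ a ∷ q ∷ M ∷ []))

  -- As a function of b for fixed 2b + D = P, the bound on M is convex, so it is at most its larger value
  -- at the endpoints b = 0 and b = P/2.
  two-regimes : ∀ b D a q M → 0ℤ ≤ b → 0ℤ ≤ D → 0ℤ ≤ a → M ≤ b * b + + 2 * b * (a + D) + q → q ≤ D * D →
    0ℤ < M → M ≤ (+ 2 * b + D) * (+ 2 * b + D) ⊎ + 4 * M ≤ (+ 2 * b + D) * (+ 2 * b + D + + 4 * a)
  two-regimes b D a q M 0≤b 0≤D 0≤a M≤ q≤D² 0<M = 
    [ inj₁ , inj₂ ∘ second ]′ (≤-or-> M ((+ 2 * b + D) * (+ 2 * b + D)))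
    where
    0≤P : 0ℤ ≤ + 2 * b + D
    0≤P = nat 2 ⊗ 0≤b ⊕ 0≤D
    0<P : 0ℤ < + 2 * b + D
    0<P = dense⇒P>0 b D a q M 0≤b 0≤D 0≤a M≤ q≤D² 0<M
    -- The endpoint bounds P² and P(P + 4a) / 4 are weighted by D and 2b, which add up to P > 0.
    impossible : (+ 2 * b + D) * (+ 2 * b + D) < M → (+ 2 * b + D) * (+ 2 * b + D + + 4 * a) < + 4 * M → ⊥
    impossible h₁ h₂ = refute
      (nat 2 ⊗ (nat 2 ⊗ 0≤D ⊗ gap< h₁ ⊕ 0≤b ⊗ gap< h₂ ⊕ 0≤P ⊗ 0≤b ⊗ 0≤D ⊕ nat 2 ⊗ 0≤P ⊗ (gap M≤ ⊕ gap q≤D²))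
       ⊕ nat 3 ⊗ 0≤D ⊕ gap< 0<P)
      (solve (b ∷ D ∷ a ∷ q ∷ M ∷ []))
    second : (+ 2 * b + D) * (+ 2 * b + D) < M → + 4 * M ≤ (+ 2 * b + D) * (+ 2 * b + D + + 4 * a)
    second h₁ = ≮⇒≥ (impossible h₁)

  -- By (KP + 2a)² - (2K - 1) P (P + 4a) = ((K - 1)P - 2a)² the hypotheses give (KP + 2a)² > 4n².
  many-regime : ∀ K P a M n → 0ℤ < K → 0ℤ ≤ P → 0ℤ ≤ a → 0ℤ ≤ n →
    + 4 * M ≤ P * (P + + 4 * a) → n * n < (+ 2 * K - + 1) * M → + 2 * n < K * P + + 2 * a
  many-regime K P a M n 0<K 0≤P 0≤a 0≤n 4M≤ n²< = ≰⇒> impossible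
    where
    impossible : ¬ K * P + + 2 * a ≤ + 2 * n
    impossible h = refute
      (gap h ⊗ (nat 2 ⊗ 0≤n ⊕ <⇒≤ 0<K ⊗ 0≤P ⊕ nat 2 ⊗ 0≤a) ⊕ sq (+ 2 * a - (K - + 1) * P)
       ⊕ (nat 2 ⊗ gap< 0<K ⊕ nat 1) ⊗ gap 4M≤ ⊕ nat 4 ⊗ gap< n²< ⊕ nat 3)
      (solve (K ∷ P ∷ a ∷ M ∷ n ∷ []))

  module System {k : ℕ} (b : Fin k → ℤ) (d : Fin k → Fin k → ℤ) (a n : ℤ)
    (b≥0 : ∀ i → 0ℤ ≤ b i) (d≥0 : ∀ i j → 0ℤ ≤ d i j) (0≤a : 0ℤ ≤ a) (0≤n : 0ℤ ≤ n) (0<k : 0ℤ < + k)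
    (fits : sum (λ i → + 2 * b i + sum (d i)) + + 2 * a ≤ + 2 * n)
    where

    D P M : Fin k → ℤ
    D i = sum (d i)
    P i = + 2 * b i + D i
    M i = b i * b i + + 2 * b i * (a + D i) + sum (λ j → d i j * d i j)

    D≥0 : ∀ i → 0ℤ ≤ D i
    D≥0 i = sum≥0 (d≥0 i)

    P≥0 : ∀ i → 0ℤ ≤ P i
    P≥0 i = nat 2 ⊗ b≥0 i ⊕ D≥0 i

    regimes : ∀ i → n * n < (+ 2 * + k - + 1) * M i → M i ≤ P i * P i ⊎ + 2 * n < + k * P i + + 2 * a
    regimes i n²< = [ inj₁ , inj₂ ∘ (λ h → many-regime (+ k) (P i) a (M i) n 0<k (P≥0 i) 0≤a 0≤n h n²<) ]′
      (two-regimes (b i) (D i) a (sum (λ j → d i j * d i j)) (M i) (b≥0 i) (D≥0 i) 0≤a ≤-refl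
        (sum-squares≤ (d≥0 i)) (0<M (+ k) (M i) n 0<k n²<))
      where
      0<M : ∀ K M n → 0ℤ < K → n * n < (+ 2 * K - + 1) * M → 0ℤ < M
      0<M K M n 0<K h = ≰⇒> impossible
        where
        impossible : ¬ M ≤ 0ℤ
        impossible M≤0 = refute (gap< h ⊕ sq n ⊕ (nat 2 ⊗ gap< 0<K ⊕ nat 1) ⊗ gap M≤0) (solve (K ∷ M ∷ n ∷ []))

    not-all-heavy : ¬ (∀ i → + 2 * n < + k * P i + + 2 * a)
    not-all-heavy heavy = lem (+ k) n a (sum P) 0<k fits (begin
      + k * (1ℤ + + 2 * n)                      ≡⟨ sym (sum-const k (1ℤ + + 2 * n)) ⟩
      sum {k} (λ _ → 1ℤ + + 2 * n)              ≤⟨ sum-mono (λ i → i<j⇒suc[i]≤j (heavy i)) ⟩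
      sum (λ i → + k * P i + + 2 * a)           ≡⟨ ∑-distrib-+ (λ i → + k * P i) (λ _ → + 2 * a) ⟩
      sum (λ i → + k * P i) + sum {k} (λ _ → + 2 * a)
        ≡⟨ cong₂ _+_ (sum-*ˡ (+ k) P) (sum-const k (+ 2 * a)) ⟩
      + k * sum P + + k * (+ 2 * a)             ∎)
      where
      open ≤-Reasoning
      lem : ∀ K n a S → 0ℤ < K → S + + 2 * a ≤ + 2 * n → K * (1ℤ + + 2 * n) ≤ K * S + K * (+ 2 * a) → ⊥
      lem K n a S 0<K h₁ h₂ = refute (<⇒≤ 0<K ⊗ gap h₁ ⊕ gap h₂ ⊕ gap< 0<K) (solve (K ∷ n ∷ a ∷ S ∷ []))

    even-impossible : ¬ (∀ i → n * n < (+ 2 * + k - + 1) * M i × + 4 * (n * n) < + k * + k * M i)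
    even-impossible h = not-all-heavy λ i → [ lem (+ k) (P i) a (M i) n 0<k (P≥0 i) 0≤a 0≤n (proj₂ (h i)) , (λ z → z) ]′
                                              (regimes i (proj₁ (h i)))
      where
      lem : ∀ K P a M n → 0ℤ < K → 0ℤ ≤ P → 0ℤ ≤ a → 0ℤ ≤ n → + 4 * (n * n) < K * K * M → M ≤ P * P →
            + 2 * n < K * P + + 2 * a
      lem K P a M n 0<K 0≤P 0≤a 0≤n h₁ h₂ = ≰⇒> impossible
        where
        impossible : ¬ K * P + + 2 * a ≤ + 2 * n
        impossible h = refute ((gap h ⊕ nat 2 ⊗ 0≤a) ⊗ (nat 2 ⊗ 0≤n ⊕ <⇒≤ 0<K ⊗ 0≤P) ⊕ sq K ⊗ gap h₂ ⊕ gap< h₁)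
          (solve (K ∷ P ∷ a ∷ M ∷ n ∷ []))

    module Odd (d-sym : ∀ i j → d i j ≡ d j i) (d-irrefl : ∀ i → d i i ≡ 0ℤ)
      (ℓ : ℤ) (0<ℓ : 0ℤ < ℓ) (dense : ∀ i → ℓ * ℓ ≤ M i)
      (narrow : + 2 * n < (+ k + + 1) * ℓ) (scarce : ∀ i → n * n < (+ 2 * + k - + 1) * M i)
      where

      y : Fin k → ℤ
      y i = b i + D i

      -- If 2n < kℓ + 2a, then either regime gives 2n < k P i + 2a for all i, which averaging
      -- excludes. Otherwise `narrow` leaves less than ℓ for 2a.
      2a<ℓ : + 2 * a < ℓ
      2a<ℓ = lem (+ k) ℓ a n (≮⇒≥ crowded) narrow
        where
        lem : ∀ K l a n → K * l + + 2 * a ≤ + 2 * n → + 2 * n < (K + + 1) * l → + 2 * a < l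
        lem K l a n h₁ h₂ = <-from (gap h₁ ⊕ gap< h₂) (solve (K ∷ l ∷ a ∷ n ∷ []))
        push : ∀ K l a n P → 0ℤ < K → + 2 * n < K * l + + 2 * a → l ≤ P → + 2 * n < K * P + + 2 * a
        push K l a n P 0<K h₁ h₂ = <-from (gap< h₁ ⊕ <⇒≤ 0<K ⊗ gap h₂) (solve (K ∷ l ∷ a ∷ n ∷ P ∷ []))
        crowded : ¬ + 2 * n < + k * ℓ + + 2 * a
        crowded h = not-all-heavy λ i →
          [ (λ M≤P² → push (+ k) ℓ a n (P i) 0<k h (≤²⇒≤ (P≥0 i) (≤-trans (dense i) M≤P²))) , (λ z → z) ]′
            (regimes i (scarce i))

      M≤y²+2ab : ∀ i → M i ≤ y i * y i + + 2 * (a * b i)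
      M≤y²+2ab i = lem (b i) (D i) a (sum (λ j → d i j * d i j)) (sum-squares≤ (d≥0 i))
        where
        lem : ∀ b D a q → q ≤ D * D → b * b + + 2 * b * (a + D) + q ≤ (b + D) * (b + D) + + 2 * (a * b)
        lem b D a q h = ≤-from (gap h) (solve (b ∷ D ∷ a ∷ q ∷ []))

      0<y : ∀ i → 0ℤ < y i
      0<y i = lem (b i) (D i) a ℓ (b≥0 i) (D≥0 i) 0≤a 0<ℓ (≤-trans (dense i) (M≤y²+2ab i))
        where
        lem : ∀ b D a l → 0ℤ ≤ b → 0ℤ ≤ D → 0ℤ ≤ a → 0ℤ < l → l * l ≤ (b + D) * (b + D) + + 2 * (a * b) → 0ℤ < b + D
        lem b D a l 0≤b 0≤D 0≤a 0<l h = ≰⇒> impossible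
          where
          impossible : ¬ b + D ≤ 0ℤ
          impossible y≤0 = refute
            (gap h ⊕ gap y≤0 ⊗ (0≤b ⊕ 0≤D ⊕ nat 2 ⊗ 0≤a) ⊕ nat 2 ⊗ 0≤a ⊗ 0≤D
             ⊕ gap< 0<l ⊗ gap< 0<l ⊕ nat 2 ⊗ gap< 0<l)
            (solve (b ∷ D ∷ a ∷ l ∷ []))

      denominators = common-denominator y b 0<y

      Y : ℤ
      Y = proj₁ denominators

      c : Fin k → ℤ
      c = proj₁ (proj₂ denominators)

      0<Y : 0ℤ < Y
      0<Y = proj₁ (proj₂ (proj₂ denominators))

      c*y≡Y*b : ∀ i → c i * y i ≡ Y * b i
      c*y≡Y*b = proj₂ (proj₂ (proj₂ denominators))

      c≥0 : ∀ i → 0ℤ ≤ c i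
      c≥0 i = ≤*⇒≤ (0<y i) (subst (0ℤ ≤_) (sym (c*y≡Y*b i)) (<⇒≤ 0<Y ⊗ b≥0 i))

      c≤Y : ∀ i → c i ≤ Y
      c≤Y i = ≤*⇒≤ (0<y i) (subst (_≤ Y * y i) (sym (c*y≡Y*b i)) (lem Y (b i) (D i) (<⇒≤ 0<Y) (D≥0 i)))
        where
        lem : ∀ Y b D → 0ℤ ≤ Y → 0ℤ ≤ D → Y * b ≤ Y * (b + D)
        lem Y b D 0≤Y 0≤D = ≤-from (0≤Y ⊗ 0≤D) (solve (Y ∷ b ∷ D ∷ []))

      -- Put θ = c / Y = b / y. Density gives ℓ² ≤ y² + 2ab ≤ (y + aθ)², so P = y(1 + θ) ≥ ℓ + (ℓ -
      -- 2a)θ because θ ≤ 1. If Σ θ ≥ 1, summation yields Σ P + 2a ≥ (k + 1)ℓ > 2n.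
      C<Y : sum c < Y
      C<Y = ≰⇒> λ Y≤C → contra (+ k) ℓ a n (sum P) (sum c) Y 0<Y Y≤C 2a<ℓ narrow fits (begin
        + k * (ℓ * Y) + (ℓ - + 2 * a) * sum c
          ≡⟨ cong₂ _+_ (sym (sum-const k (ℓ * Y))) (sym (sum-*ˡ (ℓ - + 2 * a) c)) ⟩
        sum {k} (λ _ → ℓ * Y) + sum (λ i → (ℓ - + 2 * a) * c i)
          ≡⟨ sym (∑-distrib-+ (λ _ → ℓ * Y) (λ i → (ℓ - + 2 * a) * c i)) ⟩
        sum (λ i → ℓ * Y + (ℓ - + 2 * a) * c i)
          ≤⟨ sum-mono weight ⟩
        sum (λ i → Y * P i)
          ≡⟨ sum-*ˡ Y P ⟩
        Y * sum P ∎)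
        where
        open ≤-Reasoning
        wide : ∀ b D a c Y l → 0ℤ ≤ b → 0ℤ ≤ D → 0ℤ ≤ a → 0ℤ ≤ c → 0ℤ ≤ Y → c * (b + D) ≡ Y * b →
               l * l ≤ (b + D) * (b + D) + + 2 * (a * b) → Y * l ≤ Y * (b + D) + a * c
        wide b D a c Y l 0≤b 0≤D 0≤a 0≤c 0≤Y e h = ≤²⇒≤ (0≤Y ⊗ (0≤b ⊕ 0≤D) ⊕ 0≤a ⊗ 0≤c)
          (≤-from (0≤Y ⊗ 0≤Y ⊗ gap h ⊕ sq (a * c) ⊕ nat 2 ⊗ 0≤a ⊗ 0≤Y ⊗ gap (≤-reflexive (sym e)))
            (solve (b ∷ D ∷ a ∷ c ∷ Y ∷ l ∷ [])))
        scaled : ∀ b D a c Y l → 0ℤ ≤ a → 0ℤ ≤ c → 0ℤ < Y → c ≤ Y → c * (b + D) ≡ Y * b →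
                 Y * l ≤ Y * (b + D) + a * c → l * Y + (l - + 2 * a) * c ≤ Y * (+ 2 * b + D)
        scaled b D a c Y l 0≤a 0≤c 0<Y c≤Y e h = ≤*⇒≤ 0<Y
          (≤-from ((0≤c ⊕ <⇒≤ 0<Y) ⊗ gap h ⊕ 0≤a ⊗ 0≤c ⊗ gap c≤Y ⊕ <⇒≤ 0<Y ⊗ gap (≤-reflexive e))
            (solve (b ∷ D ∷ a ∷ c ∷ Y ∷ l ∷ [])))
        weight : ∀ i → ℓ * Y + (ℓ - + 2 * a) * c i ≤ Y * P i
        weight i = scaled (b i) (D i) a (c i) Y ℓ 0≤a (c≥0 i) 0<Y (c≤Y i) (c*y≡Y*b i)
          (wide (b i) (D i) a (c i) Y ℓ (b≥0 i) (D≥0 i) 0≤a (c≥0 i) (<⇒≤ 0<Y) (c*y≡Y*b i)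
            (≤-trans (dense i) (M≤y²+2ab i)))
        contra : ∀ K l a n S C Y → 0ℤ < Y → Y ≤ C → + 2 * a < l → + 2 * n < (K + + 1) * l → S + + 2 * a ≤ + 2 * n →
                 K * (l * Y) + (l - + 2 * a) * C ≤ Y * S → ⊥
        contra K l a n S C Y 0<Y h₁ h₂ h₃ h₄ h₅ = refute
          (gap h₅ ⊕ (gap< h₂ ⊕ nat 1) ⊗ gap h₁ ⊕ <⇒≤ 0<Y ⊗ (gap< h₃ ⊕ gap h₄) ⊕ gap< 0<Y)
          (solve (K ∷ l ∷ a ∷ n ∷ S ∷ C ∷ Y ∷ []))

      -- Replacing b by b(1 + a/y) and a by 0 keeps every M above ℓ² and costs no weight, as Σ b/y < 1.
      impossible : ∀ h → + k ≡ + 1 + + 2 * h → ⊥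
      impossible = Core.odd-impossible b′ d′ (Y * ℓ) (*-pos Y ℓ 0<Y 0<ℓ)
        (λ i → <⇒≤ 0<Y ⊗ b≥0 i ⊕ 0≤a ⊗ c≥0 i) (λ i j → <⇒≤ 0<Y ⊗ d≥0 i j)
        (λ i j → cong (Y *_) (d-sym i j)) (λ i → trans (cong (Y *_) (d-irrefl i)) (*-zeroʳ Y)) dense′ light′
        where
        b′ : Fin k → ℤ
        b′ i = Y * b i + a * c i
        d′ : Fin k → Fin k → ℤ
        d′ i j = Y * d i j
        D′≡ : ∀ i → sum (d′ i) ≡ Y * D i
        D′≡ i = sum-*ˡ Y (d i)
        q′≡ : ∀ i → sum (λ j → d′ i j * d′ i j) ≡ Y * Y * sum (λ j → d i j * d i j)
        q′≡ i = trans (sum-cong-≗ (λ j → interchange Y (d i j))) (sum-*ˡ (Y * Y) (λ j → d i j * d i j))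
          where
          interchange : ∀ x y → x * y * (x * y) ≡ x * x * (y * y)
          interchange = solve-∀
        -- With θ = b / y one has θy = b, so up to the factor Y² the new left-over M exceeds the old
        -- one by (aθ)².
        dense′ : ∀ i → Y * ℓ * (Y * ℓ) ≤ b′ i * b′ i + + 2 * b′ i * sum (d′ i) + sum (λ j → d′ i j * d′ i j)
        dense′ i = subst₂ (λ u v → Y * ℓ * (Y * ℓ) ≤ b′ i * b′ i + + 2 * b′ i * u + v) (sym (D′≡ i)) (sym (q′≡ i))
          (lem (b i) (D i) a (sum (λ j → d i j * d i j)) (c i) Y ℓ 0≤a (<⇒≤ 0<Y) (c*y≡Y*b i) (dense i))
          where
          lem : ∀ b D a q c Y l → 0ℤ ≤ a → 0ℤ ≤ Y → c * (b + D) ≡ Y * b → l * l ≤ b * b + + 2 * b * (a + D) + q →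
                Y * l * (Y * l) ≤ (Y * b + a * c) * (Y * b + a * c) + + 2 * (Y * b + a * c) * (Y * D) + Y * Y * q
          lem b D a q c Y l 0≤a 0≤Y e h = ≤-from
            (0≤Y ⊗ 0≤Y ⊗ gap h ⊕ sq (a * c) ⊕ nat 2 ⊗ 0≤a ⊗ 0≤Y ⊗ gap (≤-reflexive (sym e)))
            (solve (b ∷ D ∷ a ∷ q ∷ c ∷ Y ∷ l ∷ []))
        light′ : sum (λ i → + 2 * b′ i + sum (d′ i) - Y * ℓ) < Y * ℓ
        light′ = subst (_< Y * ℓ) (sym total) (lem (+ k) ℓ a n (sum P) (sum c) Y 0<Y 0≤a C<Y narrow fits)
          where
          open ≡-Reasoning
          regroup : ∀ b D a c Y l → + 2 * (Y * b + a * c) + Y * D - Y * l ≡ Y * (+ 2 * b + D) + + 2 * a * c - Y * l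
          regroup = solve-∀
          total : sum (λ i → + 2 * b′ i + sum (d′ i) - Y * ℓ) ≡ Y * sum P + + 2 * a * sum c - + k * (Y * ℓ)
          total = begin
            sum (λ i → + 2 * b′ i + sum (d′ i) - Y * ℓ)
              ≡⟨ sum-cong-≗ (λ i → trans (cong (λ z → + 2 * b′ i + z - Y * ℓ) (D′≡ i))
                                         (regroup (b i) (D i) a (c i) Y ℓ)) ⟩
            sum (λ i → Y * P i + + 2 * a * c i - Y * ℓ)
              ≡⟨ sum-minus (λ i → Y * P i + + 2 * a * c i) (λ _ → Y * ℓ) ⟩
            sum (λ i → Y * P i + + 2 * a * c i) - sum {k} (λ _ → Y * ℓ)
              ≡⟨ cong₂ _-_ (trans (∑-distrib-+ (λ i → Y * P i) (λ i → + 2 * a * c i))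
                                  (cong₂ _+_ (sum-*ˡ Y P) (sum-*ˡ (+ 2 * a) c)))
                           (sum-const k (Y * ℓ)) ⟩
            Y * sum P + + 2 * a * sum c - + k * (Y * ℓ) ∎
          lem : ∀ K l a n S C Y → 0ℤ < Y → 0ℤ ≤ a → C < Y → + 2 * n < (K + + 1) * l → S + + 2 * a ≤ + 2 * n →
                Y * S + + 2 * a * C - K * (Y * l) < Y * l
          lem K l a n S C Y 0<Y 0≤a h₁ h₂ h₃ = <-from
            (<⇒≤ 0<Y ⊗ (gap< h₂ ⊕ gap h₃) ⊕ gap< 0<Y ⊕ nat 2 ⊗ 0≤a ⊗ (gap< h₁ ⊕ nat 1))
            (solve (K ∷ l ∷ a ∷ n ∷ S ∷ C ∷ Y ∷ []))

  -- Counting edges of a rainbow-free family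

  sum-0 : ∀ n → sum {n} (λ _ → 0ℤ) ≡ 0ℤ
  sum-0 n = trans (sum-const n 0ℤ) (*-zeroʳ (+ n))

  sum-select : ∀ {n} (p : Fin n) (f : Fin n → ℤ) → sum (λ i → indicator (i ≟ p) * f i) ≡ f p
  sum-select {ℕ.suc n} zero    f = trans (cong₂ _+_ (*-identityˡ (f zero)) (sum-0 n)) (+-identityʳ (f zero))
  sum-select {ℕ.suc n} (suc p) f = trans (+-identityˡ _) (trans
    (sum-cong-≗ (λ i → cong (_* f (suc i)) (indicator-⇔ (suc i ≟ suc p) (i ≟ p) suc-injective (cong suc))))
    (sum-select p (f ∘ suc)))

  sum-indicator : ∀ {n} (p : Fin n) → sum (λ i → indicator (i ≟ p)) ≡ + 1
  sum-indicator p = trans (sum-cong-≗ (λ i → sym (*-identityʳ (indicator (i ≟ p))))) (sum-select p (λ _ → + 1))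

  sum-product : ∀ {m n} (f : Fin m → ℤ) (g : Fin n → ℤ) → sum (λ u → sum (λ v → f u * g v)) ≡ sum f * sum g
  sum-product f g = trans (sum-cong-≗ (λ u → sum-*ˡ (f u) g)) (sum-*ʳ f (sum g))

  pos-sum : ∀ n (f : Fin n → ℕ) → + ListAction.sum (List.map f (allFin n)) ≡ sum (λ i → + f i)
  pos-sum n f = trans (cong (λ xs → + ListAction.sum xs) (map-tabulate id f)) (go f)
    where
    go : ∀ {n} (f : Fin n → ℕ) → + ListAction.sum (tabulate f) ≡ sum (λ i → + f i)
    go {ℕ.zero}  f = refl
    go {ℕ.suc n} f = trans (pos-+ (f zero) _) (cong (_+_ (+ f zero)) (go (f ∘ suc)))

  bit : Bool → ℤ
  bit x = + boolToℕ x

  bit≥0 : ∀ x → 0ℤ ≤ bit x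
  bit≥0 x = nat (boolToℕ x)

  bit≤1 : ∀ x → bit x ≤ + 1
  bit≤1 true  = ≤-refl
  bit≤1 false = nat 1

  double-count : ∀ {n} (H : Graph n) → + 2 * + edgeCount H ≡ sum (λ u → sum (λ v → bit (adj H u v)))
  double-count {n} H = begin
    + 2 * + edgeCount H                                    ≡⟨ cong (λ z → + 2 * z) edges ⟩
    + 2 * sum (λ u → sum (λ v → up u v))                   ≡⟨ twice (sum (λ u → sum (λ v → up u v))) ⟩
    sum (λ u → sum (λ v → up u v)) + sum (λ u → sum (λ v → up u v))
      ≡⟨ cong (_+_ (sum (λ u → sum (λ v → up u v)))) (∑-comm up) ⟩
    sum (λ u → sum (λ v → up u v)) + sum (λ u → sum (λ v → up v u))
      ≡⟨ sym (∑-distrib-+ (λ u → sum (λ v → up u v)) (λ u → sum (λ v → up v u))) ⟩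
    sum (λ u → sum (λ v → up u v) + sum (λ v → up v u))
      ≡⟨ sum-cong-≗ (λ u → sym (∑-distrib-+ (λ v → up u v) (λ v → up v u))) ⟩
    sum (λ u → sum (λ v → up u v + up v u))
      ≡⟨ sum-cong-≗ (λ u → sum-cong-≗ (split u)) ⟩
    sum (λ u → sum (λ v → bit (adj H u v)))                ∎
    where
    open ≡-Reasoning
    upℕ : Fin n → Fin n → ℕ
    upℕ u v = boolToℕ (⌊ toℕ u ℕ.<? toℕ v ⌋ ∧ adj H u v)
    up : Fin n → Fin n → ℤ
    up u v = + upℕ u v
    edges : + edgeCount H ≡ sum (λ u → sum (λ v → up u v))
    edges = trans (pos-sum n (λ u → ListAction.sum (List.map (upℕ u) (allFin n))))
                  (sum-cong-≗ (λ u → pos-sum n (upℕ u)))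
    twice : ∀ x → + 2 * x ≡ x + x
    twice = solve-∀
    split : ∀ u v → up u v + up v u ≡ bit (adj H u v)
    split u v with toℕ u ℕ.<? toℕ v | toℕ v ℕ.<? toℕ u | <-cmp u v
    ... | yes _ | no _  | _ = +-identityʳ _
    ... | no _  | yes _ | _ = trans (+-identityˡ _) (cong bit (adj-sym H v u))
    ... | yes p | yes q | tri< _ _ r = ⊥-elim (r q)
    ... | yes p | yes q | tri≈ r _ _ = ⊥-elim (r p)
    ... | yes p | yes q | tri> r _ _ = ⊥-elim (r p)
    ... | no p  | no q  | tri< r _ _ = ⊥-elim (p r)
    ... | no p  | no q  | tri≈ _ refl _ = cong bit (sym (irrefl H u))
    ... | no p  | no q  | tri> _ _ r = ⊥-elim (q r)

  2edges≤n² : ∀ {n} (H : Graph n) → + 2 * + edgeCount H ≤ + n * + n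
  2edges≤n² {n} H = begin
    + 2 * + edgeCount H                         ≡⟨ double-count H ⟩
    sum (λ u → sum (λ v → bit (adj H u v)))     ≤⟨ sum-mono (λ u → sum-mono (λ v → bit≤1 (adj H u v))) ⟩
    sum {n} (λ u → sum {n} (λ v → + 1))         ≡⟨ sum-cong-≗ {n} (λ u → trans (sum-const n (+ 1)) (*-identityʳ (+ n))) ⟩
    sum {n} (λ u → + n)                         ≡⟨ sum-const n (+ n) ⟩
    + n * + n                                   ∎
    where open ≤-Reasoning

  -- This is why heavy means degree 3: an end of the middle edge must be continued while avoiding
  -- the other end and the opposite end of the path.
  third-neighbour : ∀ {n} (f : Fin n → Bool) → + 3 ≤ sum (bit ∘ f) → ∀ p q → ∃[ v ] T (f v) × v ≢ p × v ≢ q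
  third-neighbour {n} f 3≤ p q with any? (λ v → T? (f v) ×-dec ¬? (v ≟ p) ×-dec ¬? (v ≟ q))
  ... | yes found = found
  ... | no none = ⊥-elim (3≰2 (≤-trans 3≤ few))
    where
    3≰2 : ¬ + 3 ≤ + 2
    3≰2 (+≤+ (ℕ.s≤s (ℕ.s≤s ())))
    ≤-indicators : ∀ v → bit (f v) ≤ indicator (v ≟ p) + indicator (v ≟ q)
    ≤-indicators v with f v in fv | v ≟ p | v ≟ q
    ... | false | P | Q = indicator≥0 P ⊕ indicator≥0 Q
    ... | true | yes _ | Q = +-monoʳ-≤ (+ 1) (indicator≥0 Q)
    ... | true | no _  | yes _ = ≤-refl
    ... | true | no v≢p | no v≢q = ⊥-elim (none (v , subst T (sym fv) tt , v≢p , v≢q))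
    few : sum (bit ∘ f) ≤ + 2
    few = ≤-trans (sum-mono ≤-indicators) (≤-reflexive
      (trans (∑-distrib-+ (λ v → indicator (v ≟ p)) (λ v → indicator (v ≟ q)))
             (cong₂ _+_ (sum-indicator p) (sum-indicator q))))

  -- Vertex types and the pairs that may carry an edge

  module _ {k : ℕ} where

    open import Data.List.Relation.Unary.All using (_∷_; [])
    open import Data.List.Relation.Unary.AllPairs using (_∷_; [])

    -- Indicators of S(v) = {i}, of S(v) = {i, j} and of |S(v)| ≥ 3, where xs lists S(v).
    pure : Fin k → List (Fin k) → ℤ
    pure i (x ∷ []) = indicator (i ≟ x)
    pure i _        = 0ℤ

    paired : Fin k → Fin k → List (Fin k) → ℤ
    paired i j (x ∷ y ∷ []) = indicator (i ≟ x) * indicator (j ≟ y) + indicator (i ≟ y) * indicator (j ≟ x)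
    paired i j _            = 0ℤ

    rich : List (Fin k) → ℤ
    rich (_ ∷ _ ∷ _ ∷ _) = + 1
    rich _               = 0ℤ

    pure≥0 : ∀ i xs → 0ℤ ≤ pure i xs
    pure≥0 i []          = nat 0
    pure≥0 i (x ∷ [])    = indicator≥0 (i ≟ x)
    pure≥0 i (_ ∷ _ ∷ _) = nat 0

    paired≥0 : ∀ i j xs → 0ℤ ≤ paired i j xs
    paired≥0 i j []              = nat 0
    paired≥0 i j (_ ∷ [])        = nat 0
    paired≥0 i j (x ∷ y ∷ [])    = indicator≥0 (i ≟ x) ⊗ indicator≥0 (j ≟ y) ⊕ indicator≥0 (i ≟ y) ⊗ indicator≥0 (j ≟ x)
    paired≥0 i j (_ ∷ _ ∷ _ ∷ _) = nat 0

    rich≥0 : ∀ xs → 0ℤ ≤ rich xs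
    rich≥0 []              = nat 0
    rich≥0 (_ ∷ [])        = nat 0
    rich≥0 (_ ∷ _ ∷ [])    = nat 0
    rich≥0 (_ ∷ _ ∷ _ ∷ _) = nat 1

    paired-sym : ∀ i j xs → paired i j xs ≡ paired j i xs
    paired-sym i j []              = refl
    paired-sym i j (_ ∷ [])        = refl
    paired-sym i j (x ∷ y ∷ [])    = lem (indicator (i ≟ x)) (indicator (j ≟ y)) (indicator (i ≟ y)) (indicator (j ≟ x))
      where
      lem : ∀ p q r s → p * q + r * s ≡ s * r + q * p
      lem = solve-∀
    paired-sym i j (_ ∷ _ ∷ _ ∷ _) = refl

    paired-irrefl : ∀ i xs → Unique xs → paired i i xs ≡ 0ℤ
    paired-irrefl i []              _ = refl
    paired-irrefl i (_ ∷ [])        _ = refl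
    paired-irrefl i (x ∷ y ∷ [])    ((x≢y ∷ _) ∷ _) with i ≟ x | i ≟ y
    ... | yes refl | yes refl = ⊥-elim (x≢y refl)
    ... | yes _    | no _     = refl
    ... | no _     | yes _    = refl
    ... | no _     | no _     = refl
    paired-irrefl i (_ ∷ _ ∷ _ ∷ _) _ = refl

    paired≡1 : ∀ {i j x y} → i ≡ x → j ≡ y → + 1 ≤ paired i j (x ∷ y ∷ [])
    paired≡1 {i} {j} refl refl rewrite indicator-yes (i ≟ i) refl | indicator-yes (j ≟ j) refl =
      +-monoʳ-≤ (+ 1) (indicator≥0 (i ≟ j) ⊗ indicator≥0 (j ≟ i))

    -- A pair is counted in both orders, while pure and rich vertices have an explicit factor 2;
    -- every type thus uses at most 2.
    total-weight : ∀ xs → sum (λ i → + 2 * pure i xs + sum (λ j → paired i j xs)) + + 2 * rich xs ≤ + 2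
    total-weight xs = subst (_≤ + 2)
      (cong (_+ + 2 * rich xs)
        (trans (cong (_+ sum (λ i → sum (λ j → paired i j xs))) (sym (sum-*ˡ (+ 2) (λ i → pure i xs))))
               (sym (∑-distrib-+ (λ i → + 2 * pure i xs) (λ i → sum (λ j → paired i j xs))))))
      (go xs)
      where
      no-pairs : sum {k} (λ i → sum {k} (λ j → 0ℤ)) ≡ 0ℤ
      no-pairs = trans (sum-cong-≗ {k} (λ i → sum-0 k)) (sum-0 k)
      one-pair : ∀ x y → sum {k} (λ i → sum {k} (λ j → indicator (i ≟ x) * indicator (j ≟ y))) ≡ + 1
      one-pair x y = trans (sum-product (λ i → indicator (i ≟ x)) (λ j → indicator (j ≟ y)))
        (cong₂ _*_ (sum-indicator x) (sum-indicator y))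
      two-pairs : ∀ x y → sum (λ i → sum (λ j → paired i j (x ∷ y ∷ []))) ≡ + 2
      two-pairs x y = trans
        (sum-cong-≗ (λ i → ∑-distrib-+ (λ j → indicator (i ≟ x) * indicator (j ≟ y))
                                       (λ j → indicator (i ≟ y) * indicator (j ≟ x))))
        (trans (∑-distrib-+ (λ i → sum (λ j → indicator (i ≟ x) * indicator (j ≟ y)))
                            (λ i → sum (λ j → indicator (i ≟ y) * indicator (j ≟ x))))
               (cong₂ _+_ (one-pair x y) (one-pair y x)))
      go : ∀ xs → + 2 * sum (λ i → pure i xs) + sum (λ i → sum (λ j → paired i j xs)) + + 2 * rich xs ≤ + 2
      go []              rewrite no-pairs | sum-0 k = nat 2
      go (x ∷ [])        rewrite sum-indicator x | no-pairs = ≤-refl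
      go (x ∷ y ∷ [])    rewrite sum-0 k | two-pairs x y = ≤-refl
      go (_ ∷ _ ∷ _ ∷ _) rewrite no-pairs | sum-0 k = ≤-refl

    two-others : ∀ (j : Fin k) {x y z xs} → Unique (x ∷ y ∷ z ∷ xs) →
      ∃[ p ] ∃[ q ] p ∈ x ∷ y ∷ z ∷ xs × q ∈ x ∷ y ∷ z ∷ xs × p ≢ q × p ≢ j × q ≢ j
    two-others j {x} {y} {z} ((x≢y ∷ x≢z ∷ _) ∷ (y≢z ∷ _) ∷ _) with x ≟ j | y ≟ j
    ... | yes refl | _        = y , z , there (here refl) , there (there (here refl)) , y≢z , x≢y ∘ sym , x≢z ∘ sym
    ... | no x≢j   | yes refl = x , z , here refl , there (there (here refl)) , x≢z , x≢j , y≢z ∘ sym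
    ... | no x≢j   | no y≢j   = x , y , here refl , there (here refl) , x≢y , x≢j , y≢j

    -- A bound for the ordered vertex pairs with lists xs and ys that may carry colour j, sorted by
    -- the type of xs: {j}, a pair containing j, rich. Rich lists count whether or not they contain
    -- j, as in the term ab of M.
    allowed₁ allowed₂ allowed₃ allowed : Fin k → List (Fin k) → List (Fin k) → ℤ
    allowed₁ j xs ys = pure j xs * (pure j ys + sum (λ i → paired j i ys) + rich ys)
    allowed₂ j xs ys = sum (λ i → paired j i xs * (pure j ys + paired j i ys))
    allowed₃ j xs ys = rich xs * pure j ys
    allowed j xs ys  = allowed₁ j xs ys + allowed₂ j xs ys + allowed₃ j xs ys

    row≥0 : ∀ j ys → 0ℤ ≤ pure j ys + sum (λ i → paired j i ys) + rich ys
    row≥0 j ys = pure≥0 j ys ⊕ sum≥0 (λ i → paired≥0 j i ys) ⊕ rich≥0 ys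

    pair-term≥0 : ∀ j xs ys i → 0ℤ ≤ paired j i xs * (pure j ys + paired j i ys)
    pair-term≥0 j xs ys i = paired≥0 j i xs ⊗ (pure≥0 j ys ⊕ paired≥0 j i ys)

    allowed≥0 : ∀ j xs ys → 0ℤ ≤ allowed j xs ys
    allowed≥0 j xs ys = pure≥0 j xs ⊗ row≥0 j ys ⊕ sum≥0 (pair-term≥0 j xs ys) ⊕ rich≥0 xs ⊗ pure≥0 j ys

    pure≡1 : ∀ {j x} → j ≡ x → pure j (x ∷ []) ≡ + 1
    pure≡1 {j} refl = indicator-yes (j ≟ j) refl

    row≥1 : ∀ {j} ys → j ∈ ys → + 1 ≤ pure j ys + sum (λ i → paired j i ys) + rich ys
    row≥1 {j} (y ∷ []) (here j≡y) rewrite pure≡1 j≡y | sum-0 k = ≤-refl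
    row≥1 {j} (y ∷ z ∷ []) (here j≡y) = subst (+ 1 ≤_) (sym (trans (+-identityʳ _) (+-identityˡ _)))
      (≤-trans (paired≡1 j≡y refl) (term≤sum (λ i → paired≥0 j i (y ∷ z ∷ [])) z))
    row≥1 {j} (y ∷ z ∷ []) (there (here j≡z)) = subst (+ 1 ≤_) (sym (trans (+-identityʳ _) (+-identityˡ _)))
      (≤-trans (subst (+ 1 ≤_) (paired-sym y j (y ∷ z ∷ [])) (paired≡1 {i = y} refl j≡z))
               (term≤sum (λ i → paired≥0 j i (y ∷ z ∷ [])) y))
    row≥1 {j} (y ∷ z ∷ w ∷ ys) _ rewrite sum-0 k = ≤-refl

    1≤* : ∀ {x y} → + 1 ≤ x → + 1 ≤ y → + 1 ≤ x * y
    1≤* {x} {y} p q = ≤-from (gap p ⊗ gap q ⊕ gap p ⊕ gap q) (lem x y)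
      where
      lem : ∀ x y → x * y - + 1 ≡ (x - + 1) * (y - + 1) + (x - + 1) + (y - + 1)
      lem = solve-∀

    module _ {j : Fin k} {xs ys : List (Fin k)} (j∈ys : j ∈ ys) (unique-ys : Unique ys) where

      -- With S(u) = {j, o} agreement leaves only {j} and {j, o} for S(v); a longer list has two
      -- different colours apart from j, and both would equal o.
      allowed-pair : ∀ {o} → + 1 ≤ paired j o xs → o ≢ j → (∀ {l} → l ∈ ys → l ≢ j → o ≡ l) → + 1 ≤ allowed j xs ys
      allowed-pair {o} 1≤o o≢j agree = ≤-trans (1≤* 1≤o (partner ys j∈ys unique-ys agree))
        (≤-trans (term≤sum (pair-term≥0 j xs ys) o)
          (≤-from (pure≥0 j xs ⊗ row≥0 j ys ⊕ rich≥0 xs ⊗ pure≥0 j ys)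
            (lem (allowed₂ j xs ys) (allowed₁ j xs ys) (allowed₃ j xs ys))))
        where
        lem : ∀ s u v → u + s + v - s ≡ u + v
        lem = solve-∀
        partner : ∀ ys → j ∈ ys → Unique ys → (∀ {l} → l ∈ ys → l ≢ j → o ≡ l) → + 1 ≤ pure j ys + paired j o ys
        partner (y ∷ []) (here j≡y) _ _ rewrite pure≡1 j≡y = ≤-refl
        partner (y ∷ z ∷ []) (here j≡y) ((y≢z ∷ _) ∷ _) agree = subst (+ 1 ≤_) (sym (+-identityˡ _))
          (paired≡1 j≡y (agree (there (here refl)) (λ z≡j → y≢z (sym (trans z≡j j≡y)))))
        partner (y ∷ z ∷ []) (there (here j≡z)) ((y≢z ∷ _) ∷ _) agree = subst (+ 1 ≤_) (sym (+-identityˡ _))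
          (subst (+ 1 ≤_) (paired-sym o j (y ∷ z ∷ []))
            (paired≡1 (agree (here refl) (λ y≡j → y≢z (trans y≡j j≡z))) j≡z))
        partner (y ∷ z ∷ w ∷ ys) _ uniq agree with two-others j uniq
        ... | p , q , p∈ , q∈ , p≢q , p≢j , q≢j = ⊥-elim (p≢q (trans (sym (agree p∈ p≢j)) (agree q∈ q≢j)))

      -- Used when S(u) has two different colours apart from j, since no further colour of S(v)
      -- could agree with both.
      allowed-rich : + 1 ≤ rich xs → (∀ {l} → l ∈ ys → l ≡ j) → + 1 ≤ allowed j xs ys
      allowed-rich 1≤r only = ≤-trans (1≤* 1≤r (pure≥1 ys j∈ys unique-ys only))
        (≤-from (pure≥0 j xs ⊗ row≥0 j ys ⊕ sum≥0 (pair-term≥0 j xs ys))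
          (lem (allowed₃ j xs ys) (allowed₁ j xs ys) (allowed₂ j xs ys)))
        where
        lem : ∀ s u v → u + v + s - s ≡ u + v
        lem = solve-∀
        pure≥1 : ∀ ys → j ∈ ys → Unique ys → (∀ {l} → l ∈ ys → l ≡ j) → + 1 ≤ pure j ys
        pure≥1 (y ∷ []) (here j≡y) _ _ = ≤-reflexive (sym (pure≡1 j≡y))
        pure≥1 (y ∷ z ∷ ys) _ ((y≢z ∷ _) ∷ _) only = ⊥-elim (y≢z (trans (only (here refl)) (sym (only (there (here refl))))))

    allowed≥1 : ∀ {j} xs ys → j ∈ xs → j ∈ ys → Unique xs → Unique ys →
      (∀ {i l} → i ∈ xs → l ∈ ys → i ≢ j → l ≢ j → i ≡ l) → + 1 ≤ allowed j xs ys
    allowed≥1 {j} (x ∷ []) ys (here j≡x) j∈ys _ _ _ = ≤-trans (1≤* (≤-reflexive (sym (pure≡1 j≡x))) (row≥1 ys j∈ys))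
      (≤-from (sum≥0 (pair-term≥0 j (x ∷ []) ys) ⊕ 0≤0*)
        (lem (allowed₁ j (x ∷ []) ys) (allowed₂ j (x ∷ []) ys) (allowed₃ j (x ∷ []) ys)))
      where
      lem : ∀ s u v → s + u + v - s ≡ u + v
      lem = solve-∀
      0≤0* : 0ℤ ≤ rich (x ∷ []) * pure j ys
      0≤0* = nat 0 ⊗ pure≥0 j ys
    allowed≥1 {j} (x ∷ y ∷ []) ys (here j≡x) j∈ys ((x≢y ∷ _) ∷ _) uniq agree =
      allowed-pair j∈ys uniq {o = y} (paired≡1 j≡x refl) y≢j (λ l∈ l≢j → agree (there (here refl)) l∈ y≢j l≢j)
      where
      y≢j : y ≢ j
      y≢j y≡j = x≢y (sym (trans y≡j j≡x))
    allowed≥1 {j} (x ∷ y ∷ []) ys (there (here j≡y)) j∈ys ((x≢y ∷ _) ∷ _) uniq agree =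
      allowed-pair j∈ys uniq {o = x} (subst (+ 1 ≤_) (paired-sym x j (x ∷ y ∷ [])) (paired≡1 {i = x} refl j≡y)) x≢j
        (λ l∈ l≢j → agree (here refl) l∈ x≢j l≢j)
      where
      x≢j : x ≢ j
      x≢j x≡j = x≢y (trans x≡j j≡y)
    allowed≥1 {j} (x ∷ y ∷ z ∷ xs) ys _ j∈ys uniq-xs uniq agree with two-others j uniq-xs
    ... | p , q , p∈ , q∈ , p≢q , p≢j , q≢j = allowed-rich {xs = x ∷ y ∷ z ∷ xs} j∈ys uniq ≤-refl only
      where
      only : ∀ {l} → l ∈ ys → l ≡ j
      only {l} l∈ with l ≟ j
      ... | yes l≡j = l≡j
      ... | no  l≢j = ⊥-elim (p≢q (trans (agree p∈ l∈ p≢j l≢j) (sym (agree q∈ l∈ q≢j l≢j))))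

  -- From edge counts to weights

  module RainbowFree {n k : ℕ} (G : Fin k → Graph n) (free : ¬ RainbowP3 G) where

    A : Fin k → Fin n → Fin n → ℤ
    A j u v = bit (adj (G j) u v)

    heavy? : ∀ u j → Dec (+ 3 ≤ sum (A j u))
    heavy? u j = + 3 ≤? sum (A j u)

    S : Fin n → List (Fin k)
    S u = filter (heavy? u) (allFin k)

    unique-S : ∀ u → Unique (S u)
    unique-S u = Unique.filter⁺ (heavy? u) (Unique.allFin⁺ k)

    -- An edge uv of colour j extends to a rainbow path by an edge of colour i at u and one of colour l at v.
    colours-agree : ∀ {j i l u v} → Edge (G j) u v → i ∈ S u → l ∈ S v → i ≢ j → l ≢ j → i ≡ l
    colours-agree {j} {i} {l} {u} {v} uv i∈ l∈ i≢j l≢j with i ≟ l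
    ... | yes i≡l = i≡l
    ... | no  i≢l with third-neighbour (adj (G i) u) (proj₂ (∈-filter⁻ (heavy? u) {xs = allFin k} i∈)) v v
    ...   | u′ , uu′ , u′≢v , _
          with third-neighbour (adj (G l) v) (proj₂ (∈-filter⁻ (heavy? v) {xs = allFin k} l∈)) u u′
    ...     | v′ , vv′ , v′≢u , v′≢u′ = ⊥-elim (free (u′ , u , v , v′ , i , j , l ,
                (edge-≢ (G i) uu′ ∘ sym , u′≢v , v′≢u′ ∘ sym , edge-≢ (G j) uv , v′≢u ∘ sym , edge-≢ (G l) vv′) ,
                (i≢j , i≢l , l≢j ∘ sym) ,
                subst T (adj-sym (G i) u u′) uu′ , uv , vv′))
      where
      edge-≢ : ∀ (H : Graph n) {x y} → Edge H x y → x ≢ y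
      edge-≢ H {x} xy refl = subst T (irrefl H x) xy

    light : Fin k → Fin n → ℤ
    light j u = indicator (¬? (heavy? u j))

    light≥0 : ∀ j u → 0ℤ ≤ light j u
    light≥0 j u = indicator≥0 (¬? (heavy? u j))

    light-row : ∀ j u → light j u * sum (A j u) ≤ + 2
    light-row j u with heavy? u j
    ... | yes _ = nat 2
    ... | no ¬h = subst (_≤ + 2) (sym (*-identityˡ (sum (A j u)))) (i<j⇒i≤pred[j] (≰⇒> ¬h))

    -- An edge is charged to an end of degree at most 2 in its colour. If there is none, then j lies
    -- in S of both ends and the pair is allowed.
    A≤ : ∀ j u v → A j u v ≤ light j u * A j u v + (light j v * A j u v + allowed j (S u) (S v))
    A≤ j u v with adj (G j) u v in uv
    ... | false = light≥0 j u ⊗ nat 0 ⊕ (light≥0 j v ⊗ nat 0 ⊕ allowed≥0 j (S u) (S v))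
    ... | true with heavy? u j | heavy? v j
    ...   | no _  | hv    = +-monoʳ-≤ (+ 1) (indicator≥0 (¬? hv) ⊗ nat 1 ⊕ allowed≥0 j (S u) (S v))
    ...   | yes _ | no _  = subst (+ 1 ≤_) (sym (+-identityˡ _)) (+-monoʳ-≤ (+ 1) (allowed≥0 j (S u) (S v)))
    ...   | yes hu | yes hv = subst (+ 1 ≤_) (sym (trans (+-identityˡ _) (+-identityˡ _)))
            (allowed≥1 (S u) (S v) (∈-filter⁺ (heavy? u) (∈-allFin j) hu) (∈-filter⁺ (heavy? v) (∈-allFin j) hv)
              (unique-S u) (unique-S v) (colours-agree (subst T (sym uv) tt)))

    b : Fin k → ℤ
    b i = sum (λ u → pure i (S u))

    d : Fin k → Fin k → ℤ
    d i j = sum (λ u → paired i j (S u))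

    a : ℤ
    a = sum (λ u → rich (S u))

    b≥0 : ∀ i → 0ℤ ≤ b i
    b≥0 i = sum≥0 (λ u → pure≥0 i (S u))

    d≥0 : ∀ i j → 0ℤ ≤ d i j
    d≥0 i j = sum≥0 (λ u → paired≥0 i j (S u))

    0≤a : 0ℤ ≤ a
    0≤a = sum≥0 (λ u → rich≥0 (S u))

    d-sym : ∀ i j → d i j ≡ d j i
    d-sym i j = sum-cong-≗ (λ u → paired-sym i j (S u))

    d-irrefl : ∀ i → d i i ≡ 0ℤ
    d-irrefl i = trans (sum-cong-≗ (λ u → paired-irrefl i (S u) (unique-S u))) (sum-0 n)

    D≡ : ∀ i → sum (d i) ≡ sum (λ u → sum (λ j → paired i j (S u)))
    D≡ i = ∑-comm (λ j u → paired i j (S u))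

    fits : sum (λ i → + 2 * b i + sum (d i)) + + 2 * a ≤ + 2 * + n
    fits = begin
      sum (λ i → + 2 * b i + sum (d i)) + + 2 * a
        ≡⟨ cong (_+ + 2 * a) (trans (sum-cong-≗ row) (∑-comm (λ i u → w i u))) ⟩
      sum (λ u → sum (λ i → w i u)) + + 2 * a
        ≡⟨ cong (_+_ (sum (λ u → sum (λ i → w i u)))) (sym (sum-*ˡ (+ 2) (λ u → rich (S u)))) ⟩
      sum (λ u → sum (λ i → w i u)) + sum (λ u → + 2 * rich (S u))
        ≡⟨ sym (∑-distrib-+ (λ u → sum (λ i → w i u)) (λ u → + 2 * rich (S u))) ⟩
      sum (λ u → sum (λ i → w i u) + + 2 * rich (S u))
        ≤⟨ sum-mono (λ u → total-weight (S u)) ⟩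
      sum {n} (λ u → + 2)
        ≡⟨ trans (sum-const n (+ 2)) (*-comm (+ n) (+ 2)) ⟩
      + 2 * + n ∎
      where
      open ≤-Reasoning
      w : Fin k → Fin n → ℤ
      w i u = + 2 * pure i (S u) + sum (λ j → paired i j (S u))
      row : ∀ i → + 2 * b i + sum (d i) ≡ sum (w i)
      row i = trans (cong₂ _+_ (sym (sum-*ˡ (+ 2) (λ u → pure i (S u)))) (D≡ i))
        (sym (∑-distrib-+ (λ u → + 2 * pure i (S u)) (λ u → sum (λ j → paired i j (S u)))))

    sum-light : ∀ j → sum (λ u → sum (λ v → light j u * A j u v)) ≤ + 2 * + n
    sum-light j = begin
      sum (λ u → sum (λ v → light j u * A j u v)) ≡⟨ sum-cong-≗ (λ u → sum-*ˡ (light j u) (A j u)) ⟩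
      sum (λ u → light j u * sum (A j u))         ≤⟨ sum-mono (light-row j) ⟩
      sum {n} (λ u → + 2)                         ≡⟨ trans (sum-const n (+ 2)) (*-comm (+ n) (+ 2)) ⟩
      + 2 * + n                                   ∎
      where open ≤-Reasoning

    sum-lightᵀ : ∀ j → sum (λ u → sum (λ v → light j v * A j u v)) ≤ + 2 * + n
    sum-lightᵀ j = ≤-trans (≤-reflexive (trans (∑-comm (λ u v → light j v * A j u v))
      (sum-cong-≗ (λ v → sum-cong-≗ (λ u → cong (λ x → light j v * bit x) (adj-sym (G j) u v)))))) (sum-light j)

    M : Fin k → ℤ
    M j = b j * b j + + 2 * b j * (a + sum (d j)) + sum (λ i → d j i * d j i)

    -- Every summand separates into a factor in u and a factor in v, so the double sum factors. The
    -- mixed terms bD and ab arise once for each order of u and v.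
    sum-allowed : ∀ j → sum (λ u → sum (λ v → allowed j (S u) (S v))) ≡ M j
    sum-allowed j = begin
      sum (λ u → sum (λ v → f₁ u v + f₂ u v + f₃ u v))
        ≡⟨ split₂ (λ u v → f₁ u v + f₂ u v) f₃ ⟩
      sum (λ u → sum (λ v → f₁ u v + f₂ u v)) + sum (λ u → sum (λ v → f₃ u v))
        ≡⟨ cong₂ _+_ (split₂ f₁ f₂) (sum-product (λ u → rich (S u)) (λ v → pure j (S v))) ⟩
      sum (λ u → sum (λ v → f₁ u v)) + sum (λ u → sum (λ v → f₂ u v)) + a * b j
        ≡⟨ cong (_+ a * b j) (cong₂ _+_ first second) ⟩
      b j * (b j + sum (d j) + a) + (b j * sum (d j) + sum (λ i → d j i * d j i)) + a * b j
        ≡⟨ lem (b j) (sum (d j)) a (sum (λ i → d j i * d j i)) ⟩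
      M j ∎
      where
      open ≡-Reasoning
      f₁ f₂ f₃ : Fin n → Fin n → ℤ
      f₁ u v = pure j (S u) * (pure j (S v) + sum (λ i → paired j i (S v)) + rich (S v))
      f₂ u v = sum (λ i → paired j i (S u) * (pure j (S v) + paired j i (S v)))
      f₃ u v = rich (S u) * pure j (S v)
      split₂ : ∀ (f g : Fin n → Fin n → ℤ) →
        sum (λ u → sum (λ v → f u v + g u v)) ≡ sum (λ u → sum (λ v → f u v)) + sum (λ u → sum (λ v → g u v))
      split₂ f g = trans (sum-cong-≗ (λ u → ∑-distrib-+ (f u) (g u))) (∑-distrib-+ (λ u → sum (f u)) (λ u → sum (g u)))
      first : sum (λ u → sum (λ v → f₁ u v)) ≡ b j * (b j + sum (d j) + a)
      first = trans (sum-product (λ u → pure j (S u)) (λ v → pure j (S v) + sum (λ i → paired j i (S v)) + rich (S v)))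
        (cong (b j *_) (trans (∑-distrib-+ (λ v → pure j (S v) + sum (λ i → paired j i (S v))) (λ v → rich (S v)))
          (cong (_+ a) (trans (∑-distrib-+ (λ v → pure j (S v)) (λ v → sum (λ i → paired j i (S v))))
            (cong (_+_ (b j)) (sym (D≡ j)))))))
      second : sum (λ u → sum (λ v → f₂ u v)) ≡ b j * sum (d j) + sum (λ i → d j i * d j i)
      second = begin
        sum (λ u → sum (λ v → f₂ u v))
          ≡⟨ sum-cong-≗ (λ u → ∑-comm (λ v i → paired j i (S u) * (pure j (S v) + paired j i (S v)))) ⟩
        sum (λ u → sum (λ i → sum (λ v → paired j i (S u) * (pure j (S v) + paired j i (S v)))))
          ≡⟨ ∑-comm (λ u i → sum (λ v → paired j i (S u) * (pure j (S v) + paired j i (S v)))) ⟩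
        sum (λ i → sum (λ u → sum (λ v → paired j i (S u) * (pure j (S v) + paired j i (S v)))))
          ≡⟨ sum-cong-≗ (λ i → trans
               (sum-product (λ u → paired j i (S u)) (λ v → pure j (S v) + paired j i (S v)))
               (trans (cong (d j i *_) (∑-distrib-+ (λ v → pure j (S v)) (λ v → paired j i (S v))))
                      (expand (d j i) (b j)))) ⟩
        sum (λ i → b j * d j i + d j i * d j i)
          ≡⟨ trans (∑-distrib-+ (λ i → b j * d j i) (λ i → d j i * d j i))
                   (cong (_+ sum (λ i → d j i * d j i)) (sum-*ˡ (b j) (d j))) ⟩
        b j * sum (d j) + sum (λ i → d j i * d j i) ∎
        where
        expand : ∀ x y → x * (y + x) ≡ y * x + x * x
        expand = solve-∀
      lem : ∀ b D a q → b * (b + D + a) + (b * D + q) + a * b ≡ b * b + + 2 * b * (a + D) + q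
      lem = solve-∀

    edges≤ : ∀ j → + 2 * + edgeCount (G j) ≤ M j + + 4 * + n
    edges≤ j = begin
      + 2 * + edgeCount (G j)
        ≡⟨ double-count (G j) ⟩
      sum (λ u → sum (λ v → A j u v))
        ≤⟨ sum-mono (λ u → sum-mono (λ v → A≤ j u v)) ⟩
      sum (λ u → sum (λ v → l₁ u v + (l₂ u v + l₃ u v)))
        ≡⟨ trans (sum-cong-≗ (λ u → trans (∑-distrib-+ (l₁ u) (λ v → l₂ u v + l₃ u v))
                                          (cong (_+_ (sum (l₁ u))) (∑-distrib-+ (l₂ u) (l₃ u)))))
                 (trans (∑-distrib-+ (λ u → sum (l₁ u)) (λ u → sum (l₂ u) + sum (l₃ u)))
                        (cong (_+_ (sum (λ u → sum (l₁ u)))) (∑-distrib-+ (λ u → sum (l₂ u)) (λ u → sum (l₃ u))))) ⟩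
      sum (λ u → sum (λ v → l₁ u v)) + (sum (λ u → sum (λ v → l₂ u v)) + sum (λ u → sum (λ v → l₃ u v)))
        ≤⟨ +-mono-≤ (sum-light j) (+-mono-≤ (sum-lightᵀ j) (≤-reflexive (sum-allowed j))) ⟩
      + 2 * + n + (+ 2 * + n + M j)
        ≡⟨ lem (+ n) (M j) ⟩
      M j + + 4 * + n ∎
      where
      open ≤-Reasoning
      l₁ l₂ l₃ : Fin n → Fin n → ℤ
      l₁ u v = light j u * A j u v
      l₂ u v = light j v * A j u v
      l₃ u v = allowed j (S u) (S v)
      lem : ∀ n m → + 2 * n + (+ 2 * n + m) ≡ m + + 4 * n
      lem = solve-∀

  -- Contradictions from large edge counts

  -- The bounds only refute the absence of a rainbow path; decidability turns this into a path.
  rainbow? : ∀ {n k} (G : Fin k → Graph n) → Dec (RainbowP3 G)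
  rainbow? G =
    any? λ v0 → any? λ v1 → any? λ v2 → any? λ v3 → any? λ i1 → any? λ i2 → any? λ i3 →
      (≢? v0 v1 ×-dec ≢? v0 v2 ×-dec ≢? v0 v3 ×-dec ≢? v1 v2 ×-dec ≢? v1 v3 ×-dec ≢? v2 v3)
      ×-dec (≢? i1 i2 ×-dec ≢? i1 i3 ×-dec ≢? i2 i3)
      ×-dec T? (adj (G i1) v0 v1) ×-dec T? (adj (G i2) v1 v2) ×-dec T? (adj (G i3) v2 v3)
    where
    ≢? : ∀ {n} (i j : Fin n) → Dec (i ≢ j)
    ≢? i j = ¬? (i ≟ j)

  module DenseRainbowFree {n k : ℕ} (G : Fin k → Graph n) (free : ¬ RainbowP3 G) (0<k : 0ℤ < + k) where

    open RainbowFree G free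

    many-colours : (∀ i → + n * + n < (+ 2 * + k - + 1) * M i) → (∀ i → + 4 * (+ n * + n) < + k * + k * M i) → ⊥
    many-colours h₁ h₂ = System.even-impossible b d a (+ n) b≥0 d≥0 0≤a (nat n) 0<k fits (λ i → h₁ i , h₂ i)

    -- All weights are multiplied by h, so that the extremal clique size n/h becomes an integer.
    odd-colours : ∀ h → 0ℤ < h → + k ≡ + 1 + + 2 * (h - + 1) → (∀ i → + n * + n < (+ 2 * + k - + 1) * M i) →
                  (∀ i → (+ n + + 1) * (+ n + + 1) ≤ h * h * M i) → ⊥
    odd-colours h 0<h k≡ scarce dense = System.Odd.impossible
      (λ i → h * b i) (λ i j → h * d i j) (h * a) (h * + n)
      (λ i → 0≤h ⊗ b≥0 i) (λ i j → 0≤h ⊗ d≥0 i j) (0≤h ⊗ 0≤a) (0≤h ⊗ nat n) 0<k fits′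
      (λ i j → cong (h *_) (d-sym i j)) (λ i → trans (cong (h *_) (d-irrefl i)) (*-zeroʳ h))
      -- Taking ℓ = n + 1 rather than n makes 2hn < (k + 1)ℓ strict, as k + 1 = 2h.
      (+ n + + 1) (<-from (nat n) (one (+ n)))
      (λ i → subst ((+ n + + 1) * (+ n + + 1) ≤_) (sym (M′≡ i)) (dense i))
      (narrow (+ k) h (+ n) 0<h k≡)
      (λ i → subst (λ m → h * + n * (h * + n) < (+ 2 * + k - + 1) * m) (sym (M′≡ i))
        (scale h (+ n) (+ 2 * + k - + 1) (M i) 0<h (scarce i)))
      (h - + 1) k≡
      where
      0≤h : 0ℤ ≤ h
      0≤h = <⇒≤ 0<h
      one : ∀ n → n + + 1 - (+ 1 + + 0) ≡ n
      one = solve-∀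
      D′≡ : ∀ i → sum (λ j → h * d i j) ≡ h * sum (d i)
      D′≡ i = sum-*ˡ h (d i)
      q′≡ : ∀ i → sum (λ j → h * d i j * (h * d i j)) ≡ h * h * sum (λ j → d i j * d i j)
      q′≡ i = trans (sum-cong-≗ (λ j → interchange h (d i j))) (sum-*ˡ (h * h) (λ j → d i j * d i j))
        where
        interchange : ∀ x y → x * y * (x * y) ≡ x * x * (y * y)
        interchange = solve-∀
      M′≡ : ∀ i → h * b i * (h * b i) + + 2 * (h * b i) * (h * a + sum (λ j → h * d i j))
                  + sum (λ j → h * d i j * (h * d i j)) ≡ h * h * M i
      M′≡ i = trans (cong₂ (λ u v → h * b i * (h * b i) + + 2 * (h * b i) * (h * a + u) + v) (D′≡ i) (q′≡ i))
        (lem h (b i) (sum (d i)) a (sum (λ j → d i j * d i j)))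
        where
        lem : ∀ h b D a q → h * b * (h * b) + + 2 * (h * b) * (h * a + h * D) + h * h * q
                            ≡ h * h * (b * b + + 2 * b * (a + D) + q)
        lem = solve-∀
      fits′ : sum (λ i → + 2 * (h * b i) + sum (λ j → h * d i j)) + + 2 * (h * a) ≤ + 2 * (h * + n)
      fits′ = subst (λ s → s + + 2 * (h * a) ≤ + 2 * (h * + n))
        (sym (trans (sum-cong-≗ (λ i → trans (cong (_+_ (+ 2 * (h * b i))) (D′≡ i)) (factor h (b i) (sum (d i)))))
                    (sum-*ˡ h (λ i → + 2 * b i + sum (d i)))))
        (lem h (sum (λ i → + 2 * b i + sum (d i))) a (+ n) 0≤h fits)
        where
        factor : ∀ h b D → + 2 * (h * b) + h * D ≡ h * (+ 2 * b + D)
        factor = solve-∀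
        lem : ∀ h S a n → 0ℤ ≤ h → S + + 2 * a ≤ + 2 * n → h * S + + 2 * (h * a) ≤ + 2 * (h * n)
        lem h S a n 0≤h le = ≤-from (0≤h ⊗ gap le) (solve (h ∷ S ∷ a ∷ n ∷ []))
      narrow : ∀ K h n → 0ℤ < h → K ≡ + 1 + + 2 * (h - + 1) → + 2 * (h * n) < (K + + 1) * (n + + 1)
      narrow K h n 0<h refl = <-from (nat 2 ⊗ gap< 0<h ⊕ nat 1) (solve (h ∷ n ∷ []))
      scale : ∀ h n c m → 0ℤ < h → n * n < c * m → h * n * (h * n) < c * (h * h * m)
      scale h n c m 0<h lt = <-from
        (sq h ⊗ gap< lt ⊕ gap< 0<h ⊗ gap< 0<h ⊕ nat 2 ⊗ gap< 0<h)
        (solve (h ∷ n ∷ c ∷ m ∷ []))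

    -- `K` is the reciprocal of the density. In `many-edges` the term 4Kn pays for the edges at
    -- light ends, and n + 1 in place of n for the strict inequalities.
    module _ (K : ℤ) (0<K : 0ℤ < K)
      (many-edges : ∀ i → (+ n + + 1) * (+ n + + 1) + + 4 * K * + n ≤ K * (+ 2 * + edgeCount (G i))) where

      KM≥ : ∀ i → (+ n + + 1) * (+ n + + 1) ≤ K * M i
      KM≥ i = lem K (+ n) (+ 2 * + edgeCount (G i)) (M i) 0<K (many-edges i) (edges≤ i)
        where
        lem : ∀ K n e m → 0ℤ < K → (n + + 1) * (n + + 1) + + 4 * K * n ≤ K * e → e ≤ m + + 4 * n →
              (n + + 1) * (n + + 1) ≤ K * m
        lem K n e m 0<K h₁ h₂ = ≤-from (gap h₁ ⊕ <⇒≤ 0<K ⊗ gap h₂) (solve (K ∷ n ∷ e ∷ m ∷ []))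

      M≥0 : ∀ i → 0ℤ ≤ M i
      M≥0 i = b≥0 i ⊗ b≥0 i ⊕ nat 2 ⊗ b≥0 i ⊗ (0≤a ⊕ sum≥0 (d≥0 i)) ⊕ sum≥0 (λ j → sq (d i j))

      LM≥ : ∀ {L} → K ≤ L → ∀ i → (+ n + + 1) * (+ n + + 1) ≤ L * M i
      LM≥ {L} K≤L i = lem K L (M i) ((+ n + + 1) * (+ n + + 1)) (M≥0 i) K≤L (KM≥ i)
        where
        lem : ∀ K L m s → 0ℤ ≤ m → K ≤ L → s ≤ K * m → s ≤ L * m
        lem K L m s 0≤m h₁ h₂ = ≤-from (gap h₂ ⊕ 0≤m ⊗ gap h₁) (solve (K ∷ L ∷ m ∷ s ∷ []))

      LM> : ∀ {L} → K ≤ L → ∀ i → + n * + n < L * M i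
      LM> {L} K≤L i = lem (+ n) (L * M i) (nat n) (LM≥ K≤L i)
        where
        lem : ∀ n x → 0ℤ ≤ n → (n + + 1) * (n + + 1) ≤ x → n * n < x
        lem n x 0≤n h = <-from (gap h ⊕ nat 2 ⊗ 0≤n) (solve (n ∷ x ∷ []))

      abstract
        many-colours-K : K ≤ + 2 * + k - + 1 → + 4 * K ≤ + k * + k → ⊥
        many-colours-K K≤ 4K≤ = many-colours (LM> K≤) λ i → lem K (+ k * + k) (M i) (+ n) (M≥0 i) 4K≤ (LM> ≤-refl i)
          where
          lem : ∀ K L m n → 0ℤ ≤ m → + 4 * K ≤ L → n * n < K * m → + 4 * (n * n) < L * m
          lem K L m n 0≤m h₁ h₂ = <-from (nat 4 ⊗ gap< h₂ ⊕ nat 3 ⊕ 0≤m ⊗ gap h₁) (solve (K ∷ L ∷ m ∷ n ∷ []))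

        odd-colours-K : ∀ h → 0ℤ < h → + k ≡ + 1 + + 2 * (h - + 1) → K ≤ + 2 * + k - + 1 → K ≤ h * h → ⊥
        odd-colours-K h 0<h k≡ K≤ K≤h² = odd-colours h 0<h k≡ (LM> K≤) (LM≥ K≤h²)

  -- Densities

  -- As `mkℚᵘ` stores the denominator less one, `1/ K` denotes 1/(K + 1); the arguments given to it
  -- are shifted by one.
  1/_ : ℕ → ℚ
  1/ K = fromℚᵘ (mkℚᵘ (+ 1) K)

  numerator-pos : ∀ {ε} → 0ℚ ℚ.< ε → 0ℤ < ℚ.numerator ε
  numerator-pos {ε} (ℚ.*<* 0<) = subst₂ _<_ (*-zeroˡ (ℚ.denominator ε)) (*-identityʳ (ℚ.numerator ε)) 0<

  scaled-homo : ∀ K ε n → toℚᵘ ((1/ K ℚ.+ ε) ℚ.* halfSq n) ℚᵘ.≃ (mkℚᵘ (+ 1) K ℚᵘ.+ toℚᵘ ε) ℚᵘ.* mkℚᵘ (+ (n ℕ.* n)) 1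
  scaled-homo K ε n = begin
    toℚᵘ ((1/ K ℚ.+ ε) ℚ.* halfSq n)                          ≈⟨ ℚ.toℚᵘ-homo-* (1/ K ℚ.+ ε) (halfSq n) ⟩
    toℚᵘ (1/ K ℚ.+ ε) ℚᵘ.* toℚᵘ (halfSq n)
      ≈⟨ ℚᵘ.*-cong (ℚᵘ.≃-trans (ℚ.toℚᵘ-homo-+ (1/ K) ε) (ℚᵘ.+-cong (ℚ.toℚᵘ-fromℚᵘ (mkℚᵘ (+ 1) K)) ℚᵘ.≃-refl))
                   (ℚ.toℚᵘ-fromℚᵘ (mkℚᵘ (+ (n ℕ.* n)) 1)) ⟩
    (mkℚᵘ (+ 1) K ℚᵘ.+ toℚᵘ ε) ℚᵘ.* mkℚᵘ (+ (n ℕ.* n)) 1    ∎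
    where open import Relation.Binary.Reasoning.Setoid ℚᵘ.≃-setoid

  -- Clears the denominators in (1/(K + 1) + P/(q + 1)) n²/2 ≤ e. Comparing the differences of the
  -- two sides serves both directions of the translation.
  cross : ∀ (K q n e : ℕ) P →
    ((+ 1 * + ℕ.suc q + P * + ℕ.suc K) * + (n ℕ.* n)) * + 1 - + e * + (ℕ.suc K ℕ.* ℕ.suc q ℕ.* 2)
    ≡ (+ ℕ.suc q + P * + ℕ.suc K) * (+ n * + n) - + ℕ.suc K * + ℕ.suc q * (+ 2 * + e)
  cross K q n e P = trans
    (cong₂ (λ u v → ((+ 1 * + ℕ.suc q + P * + ℕ.suc K) * u) * + 1 - + e * v) (pos-* n n)
      (trans (pos-* (ℕ.suc K ℕ.* ℕ.suc q) 2) (cong (_* + 2) (pos-* (ℕ.suc K) (ℕ.suc q)))))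
    (lem (+ ℕ.suc K) (+ ℕ.suc q) (+ n) (+ e) P)
    where
    lem : ∀ K q n e P → ((+ 1 * q + P * K) * (n * n)) * + 1 - e * (K * q * + 2) ≡ (q + P * K) * (n * n) - K * q * (+ 2 * e)
    lem = solve-∀

  swap-gap : ∀ x y x′ y′ → x - y ≡ x′ - y′ → x ≤ y → x′ ≤ y′
  swap-gap x y x′ y′ e h = ≤-from (gap h) (trans (flip x′ y′) (trans (cong -_ (sym e)) (sym (flip x y))))
    where
    flip : ∀ x y → y - x ≡ - (x - y)
    flip = solve-∀

  density⇒edges : ∀ K ε n e → (1/ K ℚ.+ ε) ℚ.* halfSq n ℚ.≤ ℕtoℚ e →
    (ℚ.denominator ε + ℚ.numerator ε * + ℕ.suc K) * (+ n * + n) ≤ + ℕ.suc K * ℚ.denominator ε * (+ 2 * + e)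
  density⇒edges K ε@(mkℚ P q _) n e h = swap-gap _ _ _ _ (cross K q n e P)
    (ℚᵘ.drop-*≤* (ℚᵘ.≤-respʳ-≃ (ℚ.toℚᵘ-fromℚᵘ (mkℚᵘ (+ e) 0)) (ℚᵘ.≤-respˡ-≃ (scaled-homo K ε n) (ℚ.toℚᵘ-mono-≤ h))))

  edges⇒density : ∀ K ε n e →
    (ℚ.denominator ε + ℚ.numerator ε * + ℕ.suc K) * (+ n * + n) ≤ + ℕ.suc K * ℚ.denominator ε * (+ 2 * + e) →
    (1/ K ℚ.+ ε) ℚ.* halfSq n ℚ.≤ ℕtoℚ e
  edges⇒density K ε@(mkℚ P q _) n e h = ℚ.toℚᵘ-cancel-≤
    (ℚᵘ.≤-respʳ-≃ (ℚᵘ.≃-sym (ℚ.toℚᵘ-fromℚᵘ (mkℚᵘ (+ e) 0))) (ℚᵘ.≤-respˡ-≃ (ℚᵘ.≃-sym (scaled-homo K ε n))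
      (ℚᵘ.*≤* (swap-gap _ _ _ _ (sym (cross K q n e P)) h))))

  0<+suc : ∀ m → 0ℤ < + ℕ.suc m
  0<+suc m = +<+ (ℕ.s≤s ℕ.z≤n)

  too-dense : ∀ n e → 0ℤ ≤ n → (n + + 1) * (n + + 1) + + 4 * + 1 * n ≤ + 1 * e → e ≤ n * n → ⊥
  too-dense n e 0≤n h₁ h₂ = refute (gap h₁ ⊕ gap h₂ ⊕ nat 6 ⊗ 0≤n) (solve (n ∷ e ∷ []))

  sparse-K : ∀ m → + 13 + + 2 * (+ 1 + m) ≡ + 15 + + 2 * m
  sparse-K = solve-∀

  sparse-k : ∀ m → + 15 + + 2 * m ≡ + 2 * (+ 8 + m) - + 1
  sparse-k = solve-∀

  -- This is 4(2k - 1) ≤ k² for k = m + 8, which fails at k = 7.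
  4K≤k² : ∀ m → 0ℤ ≤ m → + 4 * (+ 15 + + 2 * m) ≤ (+ 8 + m) * (+ 8 + m)
  4K≤k² m 0≤m = ≤-from (sq m ⊕ nat 8 ⊗ 0≤m ⊕ nat 4) (solve (m ∷ []))

  module _ {ε : ℚ} (0<ε : 0ℚ ℚ.< ε) {n : ℕ} (n-large : n ℕ.≥ 7 ℕ.* ℚ.denominatorℕ ε) where

    -- Write K for `suc K` and Q for the denominator of ε. As the numerator of ε is at least 1, it
    -- contributes Kn² ≥ 7KQn after clearing denominators, and 7Kn ≥ 4Kn + 2n + 1 covers the
    -- lower-order terms.
    dense⇒many-edges : ∀ K e {φ} → φ ≡ 1/ K → (φ ℚ.+ ε) ℚ.* halfSq n ℚ.≤ ℕtoℚ e →
      (+ n + + 1) * (+ n + + 1) + + 4 * + ℕ.suc K * + n ≤ + ℕ.suc K * (+ 2 * + e)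
    dense⇒many-edges K e refl h = lem (+ ℕ.suc K) (ℚ.denominator ε) (ℚ.numerator ε) (+ n) (+ 2 * + e)
      (0<+suc K) (0<+suc _) (numerator-pos 0<ε) (nat n)
      (subst (_≤ + n) (pos-* 7 (ℚ.denominatorℕ ε)) (+≤+ n-large)) (density⇒edges K ε n e h)
      where
      lem : ∀ K Q P n e → 0ℤ < K → 0ℤ < Q → 0ℤ < P → 0ℤ ≤ n → + 7 * Q ≤ n → (Q + P * K) * (n * n) ≤ K * Q * e →
            (n + + 1) * (n + + 1) + + 4 * K * n ≤ K * e
      lem K Q P n e 0<K 0<Q 0<P 0≤n 7Q≤n h = ≤*⇒≤ 0<Q
        (≤-from (gap h ⊕ gap< 0<P ⊗ <⇒≤ 0<K ⊗ sq n ⊕ <⇒≤ 0<K ⊗ 0≤n ⊗ gap 7Q≤n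
                 ⊕ <⇒≤ 0<Q ⊗ (gap 7Q≤n ⊕ nat 7 ⊗ gap< 0<Q ⊕ nat 6 ⊕ nat 3 ⊗ gap< 0<K ⊗ 0≤n))
          (solve (K ∷ Q ∷ P ∷ n ∷ e ∷ [])))

    abstract
      -- This settles k ≤ 2, where f k = 1, while no graph has more than n² / 2 edges.
      too-many : (H : Graph n) {φ : ℚ} → φ ≡ 1/ 0 → (φ ℚ.+ ε) ℚ.* halfSq n ℚ.≤ ℕtoℚ (edgeCount H) → ⊥
      too-many H φ≡ h = too-dense (+ n) (+ 2 * + edgeCount H) (nat n) (dense⇒many-edges 0 (edgeCount H) φ≡ h) (2edges≤n² H)

    dense⇒rainbow : ∀ k → k ℕ.≥ 1 → (G : Fin k → Graph n) →
      (∀ i → (f k ℚ.+ ε) ℚ.* halfSq n ℚ.≤ ℕtoℚ (edgeCount (G i))) → RainbowP3 G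
    dense⇒rainbow k k≥1 G dense = decidable-stable (rainbow? G) (impossible k k≥1 G dense)
      where
      ≤-by : ∀ {x} c → + x ≤ + (c ℕ.+ x)
      ≤-by {x} c = +≤+ (ℕ.m≤n+m x c)
      impossible : ∀ k → k ℕ.≥ 1 → (G : Fin k → Graph n) →
        (∀ i → (f k ℚ.+ ε) ℚ.* halfSq n ℚ.≤ ℕtoℚ (edgeCount (G i))) → ¬ ¬ RainbowP3 G
      impossible 1 _ G dense _ = too-many (G zero) {f 1} refl (dense zero)
      impossible 2 _ G dense _ = too-many (G zero) {f 2} refl (dense zero)
      -- For k = 3, 5, 7 the condition 4K ≤ k² of the averaging argument fails, and the matching
      -- argument is applied with h = (k + 1) / 2.
      impossible 3 _ G dense free = DenseRainbowFree.odd-colours-K G free (0<+suc _) (+ 4) (0<+suc _)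
        (λ i → dense⇒many-edges 3 (edgeCount (G i)) {f 3} refl (dense i)) (+ 2) (0<+suc _) refl (≤-by 1) (≤-by 0)
      impossible 4 _ G dense free = DenseRainbowFree.many-colours-K G free (0<+suc _) (+ 4) (0<+suc _)
        (λ i → dense⇒many-edges 3 (edgeCount (G i)) {f 4} refl (dense i)) (≤-by 3) (≤-by 0)
      impossible 5 _ G dense free = DenseRainbowFree.odd-colours-K G free (0<+suc _) (+ 9) (0<+suc _)
        (λ i → dense⇒many-edges 8 (edgeCount (G i)) {f 5} refl (dense i)) (+ 3) (0<+suc _) refl (≤-by 0) (≤-by 0)
      impossible 6 _ G dense free = DenseRainbowFree.many-colours-K G free (0<+suc _) (+ 9) (0<+suc _)
        (λ i → dense⇒many-edges 8 (edgeCount (G i)) {f 6} refl (dense i)) (≤-by 2) (≤-by 0)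
      -- Here K = 2k - 1 = 13 is the binding condition, and K ≤ h² = 16 has room.
      impossible 7 _ G dense free = DenseRainbowFree.odd-colours-K G free (0<+suc _) (+ 13) (0<+suc _)
        (λ i → dense⇒many-edges 12 (edgeCount (G i)) {f 7} refl (dense i)) (+ 4) (0<+suc _) refl (≤-by 0) (≤-by 3)
      impossible (ℕ.suc (ℕ.suc (ℕ.suc (ℕ.suc (ℕ.suc (ℕ.suc (ℕ.suc (ℕ.suc m)))))))) _ G dense free =
        DenseRainbowFree.many-colours-K G free (0<+suc _) (+ K) (0<+suc _)
          (λ i → dense⇒many-edges (ℕ.pred K) (edgeCount (G i)) {f (8 ℕ.+ m)} refl (dense i))
          (≤-reflexive (trans K≡′ (trans (sparse-k (+ m)) (cong (λ z → + 2 * z - + 1) (sym k≡)))))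
          (subst₂ (λ u v → + 4 * u ≤ v * v) (sym K≡′) (sym k≡) (4K≤k² (+ m) (nat m)))
        where
        K : ℕ
        K = 13 ℕ.+ 2 ℕ.* ℕ.suc m
        K≡′ : + K ≡ + 15 + + 2 * + m
        K≡′ = trans (pos-+ 13 (2 ℕ.* ℕ.suc m)) (trans (cong (_+_ (+ 13)) (pos-* 2 (ℕ.suc m))) (sparse-K (+ m)))
        k≡ : + (8 ℕ.+ m) ≡ + 8 + + m
        k≡ = pos-+ 8 m

  -- Block graphs

  module _ {n : ℕ} {_~_ : Fin n → Fin n → Set} (_~?_ : Decidable _~_) (~-sym : Symmetric _~_)
    (~-irrefl : ∀ i → ¬ i ~ i) where

    graphOf : Graph n
    graphOf = record
      { adj    = λ i j → ⌊ i ~? j ⌋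
      ; sym    = λ i j → does-sym (i ~? j) (j ~? i)
      ; irrefl = λ i → does-irrefl (i ~? i)
      }
      where
      does-sym : ∀ {i j} (p : Dec (i ~ j)) (q : Dec (j ~ i)) → ⌊ p ⌋ ≡ ⌊ q ⌋
      does-sym (yes _) (yes _) = refl
      does-sym (yes p) (no ¬q) = ⊥-elim (¬q (~-sym p))
      does-sym (no ¬p) (yes q) = ⊥-elim (¬p (~-sym q))
      does-sym (no _)  (no _)  = refl
      does-irrefl : ∀ {i} (p : Dec (i ~ i)) → ⌊ p ⌋ ≡ false
      does-irrefl (yes p) = ⊥-elim (~-irrefl _ p)
      does-irrefl (no _)  = refl

    edge⇒~ : ∀ {i j} → Edge graphOf i j → i ~ j
    edge⇒~ {i} {j} = toWitness {a? = i ~? j}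

    bit-adj : ∀ i j → bit (adj graphOf i j) ≡ indicator (i ~? j)
    bit-adj i j with i ~? j
    ... | yes _ = refl
    ... | no  _ = refl

  count-below : ∀ {n} m → m ℕ.≤ n → sum {n} (λ v → indicator (toℕ v ℕ.<? m)) ≡ + m
  count-below {n} ℕ.zero _ = trans (sum-cong-≗ {n} (λ v → indicator-no (toℕ v ℕ.<? 0) λ ())) (sum-0 n)
  count-below {ℕ.suc n} (ℕ.suc m) (ℕ.s≤s m≤n) = trans
    (cong (_+_ (+ 1)) (trans (sum-cong-≗ {n} (λ v → indicator-⇔ (ℕ.suc (toℕ v) ℕ.<? ℕ.suc m) (toℕ v ℕ.<? m) ℕ.s≤s⁻¹ ℕ.s≤s))
                             (count-below m m≤n)))
    refl

  -- Outside is empty in the clique construction (k ≤ 6), and all of {v ≥ H s} for k ≥ 7.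
  module Blocks (n s H : ℕ) (Hs≤n : H ℕ.* s ℕ.≤ n) (Outside : Fin n → Set) (outside? : ∀ v → Dec (Outside v))
    (outside⇒≥ : ∀ v → Outside v → H ℕ.* s ℕ.≤ toℕ v) where

    -- The bound in `end` is `suc (toℕ c) * s` by computation, so that monotonicity and cancellation
    -- of multiplication apply directly.
    record Block (c : Fin H) (v : Fin n) : Set where
      constructor within
      field
        start : toℕ c ℕ.* s ℕ.≤ toℕ v
        end   : toℕ v ℕ.< s ℕ.+ toℕ c ℕ.* s

    block? : ∀ c v → Dec (Block c v)
    block? c v = map′ (λ (p , q) → within p q) (λ (within p q) → p , q)
      (toℕ c ℕ.* s ℕ.≤? toℕ v ×-dec toℕ v ℕ.<? s ℕ.+ toℕ c ℕ.* s)

    end≤ : ∀ (c : Fin H) → s ℕ.+ toℕ c ℕ.* s ℕ.≤ H ℕ.* s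
    end≤ c = ℕ.*-monoˡ-≤ s (toℕ<n c)

    block⇒inside : ∀ {c v} → Block c v → ¬ Outside v
    block⇒inside {c} {v} (within _ v<) out = ℕ.<⇒≱ (ℕ.<-≤-trans v< (end≤ c)) (outside⇒≥ v out)

    block-unique : ∀ {c c′ v} → Block c v → Block c′ v → c ≡ c′
    block-unique {c} {c′} (within c≤v v<c) (within c′≤v v<c′) = toℕ-injective (ℕ.≤-antisym (below c≤v v<c′) (below c′≤v v<c))
      where
      below : ∀ {x y w} → x ℕ.* s ℕ.≤ w → w ℕ.< ℕ.suc y ℕ.* s → x ℕ.≤ y
      below xs≤w w<ys = ℕ.s≤s⁻¹ (ℕ.*-cancelʳ-< s _ _ (ℕ.≤-<-trans xs≤w w<ys))

    Joined : Fin H → Fin n → Fin n → Set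
    Joined c u v = (Block c u × Block c v) ⊎ (Block c u × Outside v) ⊎ (Outside u × Block c v)

    joined? : ∀ c → Decidable (Joined c)
    joined? c u v = (block? c u ×-dec block? c v) ⊎-dec (block? c u ×-dec outside? v) ⊎-dec (outside? u ×-dec block? c v)

    joined-sym : ∀ {c} → Symmetric (Joined c)
    joined-sym (inj₁ (p , q))        = inj₁ (q , p)
    joined-sym (inj₂ (inj₁ (p , q))) = inj₂ (inj₂ (q , p))
    joined-sym (inj₂ (inj₂ (p , q))) = inj₂ (inj₁ (q , p))

    Adjacent : Fin H → Fin n → Fin n → Set
    Adjacent c u v = u ≢ v × Joined c u v

    adjacent? : ∀ c → Decidable (Adjacent c)
    adjacent? c u v = ¬? (u ≟ v) ×-dec joined? c u v

    adjacent-sym : ∀ {c} → Symmetric (Adjacent c)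
    adjacent-sym (u≢v , j) = u≢v ∘ sym , joined-sym j

    adjacent-irrefl : ∀ {c} u → ¬ Adjacent c u u
    adjacent-irrefl u (u≢u , _) = u≢u refl

    blockGraph : Fin H → Graph n
    blockGraph c = graphOf (adjacent? c) adjacent-sym adjacent-irrefl

    edge⇒joined : ∀ c {u v} → Edge (blockGraph c) u v → Joined c u v
    edge⇒joined c e = proj₂ (edge⇒~ (adjacent? c) adjacent-sym adjacent-irrefl e)

    joined⇒same-block : ∀ {c c′ u v} → Joined c u v → Block c′ v → c ≡ c′
    joined⇒same-block (inj₁ (_ , q))         q′ = block-unique q q′
    joined⇒same-block (inj₂ (inj₁ (_ , out))) q′ = ⊥-elim (block⇒inside q′ out)
    joined⇒same-block (inj₂ (inj₂ (_ , q)))  q′ = block-unique q q′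

    -- An end of the middle edge lies in its block, and then so does an adjacent edge of the path.
    path-blocks : ∀ {c₁ c₂ c₃ v₀ v₁ v₂ v₃} → Joined c₁ v₀ v₁ → Joined c₂ v₁ v₂ → Joined c₃ v₂ v₃ →
                  c₁ ≡ c₂ ⊎ c₃ ≡ c₂
    path-blocks j₁ (inj₁ (p , _))        j₃ = inj₁ (joined⇒same-block j₁ p)
    path-blocks j₁ (inj₂ (inj₁ (p , _))) j₃ = inj₁ (joined⇒same-block j₁ p)
    path-blocks j₁ (inj₂ (inj₂ (_ , q))) j₃ = inj₂ (joined⇒same-block (joined-sym j₃) q)

    path-one-block : (∀ v → ¬ Outside v) → ∀ {c₁ c₂ c₃ v₀ v₁ v₂ v₃} →
                     Joined c₁ v₀ v₁ → Joined c₂ v₁ v₂ → Joined c₃ v₂ v₃ → c₁ ≡ c₂ × c₃ ≡ c₂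
    path-one-block none j₁ (inj₁ (p , q))          j₃ = joined⇒same-block j₁ p , joined⇒same-block (joined-sym j₃) q
    path-one-block none j₁ (inj₂ (inj₁ (_ , out))) j₃ = ⊥-elim (none _ out)
    path-one-block none j₁ (inj₂ (inj₂ (out , _))) j₃ = ⊥-elim (none _ out)

    β : Fin H → Fin n → ℤ
    β c v = indicator (block? c v)

    o : Fin n → ℤ
    o v = indicator (outside? v)

    sum-β : ∀ c → sum (β c) ≡ + s
    sum-β c = begin
      sum (β c)                                           ≡⟨ sum-cong-≗ β≡ ⟩
      sum (λ v → below (s ℕ.+ t) v - below t v)           ≡⟨ sum-minus (below (s ℕ.+ t)) (below t) ⟩
      sum (below (s ℕ.+ t)) - sum (below t)
        ≡⟨ cong₂ _-_ (count-below (s ℕ.+ t) end≤n) (count-below t (ℕ.≤-trans (ℕ.m≤n+m t s) end≤n)) ⟩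
      + (s ℕ.+ t) - + t                                   ≡⟨ cong (_- + t) (pos-+ s t) ⟩
      + s + + t - + t                                     ≡⟨ cancel (+ s) (+ t) ⟩
      + s                                                 ∎
      where
      open ≡-Reasoning
      t : ℕ
      t = toℕ c ℕ.* s
      end≤n : s ℕ.+ t ℕ.≤ n
      end≤n = ℕ.≤-trans (end≤ c) Hs≤n
      below : ℕ → Fin n → ℤ
      below m v = indicator (toℕ v ℕ.<? m)
      cancel : ∀ x y → x + y - y ≡ x
      cancel = solve-∀
      β≡ : ∀ v → β c v ≡ below (s ℕ.+ t) v - below t v
      β≡ v with toℕ v ℕ.<? t
      ... | yes v<t rewrite indicator-no (block? c v) (λ b → ℕ.<⇒≱ v<t (Block.start b))
                          | indicator-yes (toℕ v ℕ.<? s ℕ.+ t) (ℕ.≤-trans v<t (ℕ.m≤n+m t s)) = refl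
      ... | no  v≮t = trans (indicator-⇔ (block? c v) (toℕ v ℕ.<? s ℕ.+ t) Block.end (within (ℕ.≮⇒≥ v≮t)))
                            (sym (+-identityʳ _))

    -- The product of a block with itself contains the diagonal, which carries no edges; the
    -- indicator of v = u absorbs it.
    pairs≤ : ∀ c u v → β c u * β c v + (β c u * o v + o u * β c v) ≤ bit (adj (blockGraph c) u v) + indicator (v ≟ u)
    pairs≤ c u v = ≤-trans pairs≤joined (≤-trans joined≤ (≤-reflexive
      (cong (_+ indicator (v ≟ u)) (sym (bit-adj (adjacent? c) adjacent-sym adjacent-irrefl u v)))))
      where
      pairs≤joined : β c u * β c v + (β c u * o v + o u * β c v) ≤ indicator (joined? c u v)
      pairs≤joined with block? c u | block? c v | outside? u | outside? v
      ... | yes p | _     | yes x | _     = ⊥-elim (block⇒inside p x)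
      ... | _     | yes q | _     | yes y = ⊥-elim (block⇒inside q y)
      ... | yes _ | yes _ | no _  | no _  = ≤-refl
      ... | yes _ | no _  | no _  | yes _ = ≤-refl
      ... | yes _ | no _  | no _  | no _  = nat 0
      ... | no _  | yes _ | yes _ | no _  = ≤-refl
      ... | no _  | yes _ | no _  | no _  = nat 0
      ... | no _  | no _  | yes _ | yes _ = nat 0
      ... | no _  | no _  | yes _ | no _  = nat 0
      ... | no _  | no _  | no _  | yes _ = nat 0
      ... | no _  | no _  | no _  | no _  = nat 0
      joined≤ : indicator (joined? c u v) ≤ indicator (adjacent? c u v) + indicator (v ≟ u)
      joined≤ = lem (joined? c u v) (adjacent? c u v) (v ≟ u) (λ j v≢u → v≢u ∘ sym , j)
        where
        lem : ∀ {P Q R : Set} (p : Dec P) (q : Dec Q) (r : Dec R) → (P → ¬ R → Q) →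
              indicator p ≤ indicator q + indicator r
        lem (no _)  q       r       _ = indicator≥0 q ⊕ indicator≥0 r
        lem (yes _) q       (yes _) _ = +-monoˡ-≤ (+ 1) (indicator≥0 q)
        lem (yes _) (yes _) (no _)  _ = ≤-refl
        lem (yes p) (no ¬q) (no ¬r) h = ⊥-elim (¬q (h p ¬r))

    block-edges : ∀ c → + s * + s + + 2 * + s * sum o ≤ + 2 * + edgeCount (blockGraph c) + + n
    block-edges c = begin
      + s * + s + + 2 * + s * sum o
        ≡⟨ trans (regroup (+ s) (sum o)) (cong (λ z → z * z + (z * sum o + sum o * z)) (sym (sum-β c))) ⟩
      sum (β c) * sum (β c) + (sum (β c) * sum o + sum o * sum (β c))
        ≡⟨ sym (cong₂ _+_ (sum-product (β c) (β c)) (cong₂ _+_ (sum-product (β c) o) (sum-product o (β c)))) ⟩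
      ΣΣ (λ u v → β c u * β c v) + (ΣΣ (λ u v → β c u * o v) + ΣΣ (λ u v → o u * β c v))
        ≡⟨ sym (trans (ΣΣ-+ (λ u v → β c u * β c v) (λ u v → β c u * o v + o u * β c v))
                      (cong (_+_ (ΣΣ (λ u v → β c u * β c v))) (ΣΣ-+ (λ u v → β c u * o v) (λ u v → o u * β c v)))) ⟩
      ΣΣ (λ u v → β c u * β c v + (β c u * o v + o u * β c v))
        ≤⟨ sum-mono (λ u → sum-mono (pairs≤ c u)) ⟩
      ΣΣ (λ u v → bit (adj (blockGraph c) u v) + indicator (v ≟ u))
        ≡⟨ ΣΣ-+ (λ u v → bit (adj (blockGraph c) u v)) (λ u v → indicator (v ≟ u)) ⟩
      ΣΣ (λ u v → bit (adj (blockGraph c) u v)) + ΣΣ (λ u v → indicator (v ≟ u))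
        ≡⟨ cong₂ _+_ (sym (double-count (blockGraph c)))
             (trans (sum-cong-≗ {n} sum-indicator) (trans (sum-const n (+ 1)) (*-identityʳ (+ n)))) ⟩
      + 2 * + edgeCount (blockGraph c) + + n ∎
      where
      open ≤-Reasoning
      ΣΣ : (Fin n → Fin n → ℤ) → ℤ
      ΣΣ g = sum (λ u → sum (g u))
      ΣΣ-+ : ∀ g h → ΣΣ (λ u v → g u v + h u v) ≡ ΣΣ g + ΣΣ h
      ΣΣ-+ g h = trans (sum-cong-≗ (λ u → ∑-distrib-+ (g u) (h u))) (∑-distrib-+ (λ u → sum (g u)) (λ u → sum (h u)))
      regroup : ∀ s x → s * s + + 2 * s * x ≡ s * s + (s * x + x * s)
      regroup = solve-∀

  -- Rounding and the two extremal families

  division : ∀ n K → + n ≡ + (n ℕ.% ℕ.suc K) + + (n ℕ./ ℕ.suc K) * + ℕ.suc K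
  division n K = trans (cong +_ (ℕ.m≡m%n+[m/n]*n n (ℕ.suc K)))
    (trans (pos-+ (n ℕ.% ℕ.suc K) _) (cong (_+_ (+ (n ℕ.% ℕ.suc K))) (pos-* (n ℕ./ ℕ.suc K) (ℕ.suc K))))

  remainder≤ : ∀ n K → + (n ℕ.% ℕ.suc K) ≤ + ℕ.suc K
  remainder≤ n K = +≤+ (ℕ.<⇒≤ (ℕ.m%n<n n (ℕ.suc K)))

  blocks≤n : ∀ n {H K} → H ℕ.≤ ℕ.suc K → H ℕ.* (n ℕ./ ℕ.suc K) ℕ.≤ n
  blocks≤n n {H} {K} H≤K = ℕ.≤-trans (ℕ.*-monoˡ-≤ (n ℕ./ ℕ.suc K) H≤K)
    (subst (ℕ._≤ n) (ℕ.*-comm (n ℕ./ ℕ.suc K) (ℕ.suc K)) (ℕ.m/n*n≤m n (ℕ.suc K)))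

  -- Since sH = n - ρ, one has H²s² ≥ n² - 2ρn, and ρ ≤ H lets the term 4H²n absorb the rounding and
  -- the diagonal.
  clique-count : ∀ n s ρ H e → n ≡ ρ + s * H → 0ℤ ≤ n → 0ℤ ≤ s → ρ ≤ n → ρ ≤ H → 0ℤ < H →
                 s * s + + 2 * s * + 0 ≤ e + n → n * n ≤ H * H * (e + + 4 * n)
  clique-count n s ρ H e n≡ 0≤n 0≤s ρ≤n ρ≤H 0<H h = ≤-from
    (sq H ⊗ gap h ⊕ gap (≤-reflexive n≡) ⊗ (0≤s ⊗ <⇒≤ 0<H ⊕ gap ρ≤n) ⊕ sq ρ
     ⊕ 0≤n ⊗ (sq H ⊕ nat 2 ⊗ <⇒≤ 0<H ⊗ gap< 0<H ⊕ nat 2 ⊗ gap ρ≤H))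
    (solve (n ∷ s ∷ ρ ∷ H ∷ e ∷ []))

  -- For K = 2H - 1 the left side of the last hypothesis is s(2n - Ks) = s(n + ρ), and Ks(n + ρ) =
  -- (n - ρ)(n + ρ). The error ρ² is at most Kn.
  star-count : ∀ n s ρ H K e → K ≡ + 2 * H - + 1 → n ≡ ρ + s * K → 0ℤ ≤ n → 0ℤ ≤ ρ → 0ℤ ≤ K → ρ ≤ n → ρ ≤ K →
               s * s + + 2 * s * (n - H * s) ≤ e + n → n * n ≤ K * (e + + 4 * n)
  star-count n s ρ H K e K≡ n≡ 0≤n 0≤ρ 0≤K ρ≤n ρ≤K h = ≤-from
    (0≤K ⊗ gap h ⊕ 0≤K ⊗ sq s ⊗ gap (≤-reflexive (sym K≡))
     ⊕ gap (≤-reflexive n≡) ⊗ (0≤ρ ⊕ (gap (≤-reflexive (sym n≡)) ⊕ 0≤ρ))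
     ⊕ nat 2 ⊗ 0≤K ⊗ 0≤n ⊕ 0≤K ⊗ gap ρ≤n ⊕ 0≤ρ ⊗ gap ρ≤K)
    (solve (n ∷ s ∷ ρ ∷ H ∷ K ∷ e ∷ []))

  -- The loss 4KQn is at most Kn² because 4Q ≤ n, hence at most PKn².
  below-density : ∀ K Q P n e → 0ℤ < K → 0ℤ < P → 0ℤ ≤ Q → 0ℤ ≤ n → + 4 * Q ≤ n → n * n ≤ K * (e + + 4 * n) →
                  (Q + - P * K) * (n * n) ≤ K * Q * e
  below-density K Q P n e 0<K 0<P 0≤Q 0≤n 4Q≤n h = ≤-from
    (0≤Q ⊗ gap h ⊕ gap< 0<P ⊗ <⇒≤ 0<K ⊗ sq n ⊕ <⇒≤ 0<K ⊗ 0≤n ⊗ gap 4Q≤n)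
    (solve (K ∷ Q ∷ P ∷ n ∷ e ∷ []))

  -- Decided so that the explicit assignments of colours to cliques are checked by evaluation.
  two-per-block? : ∀ {k H} (κ : Fin k → Fin H) → Dec (∀ i j l → κ i ≡ κ j → κ l ≡ κ j → i ≡ j ⊎ i ≡ l ⊎ j ≡ l)
  two-per-block? κ = all? λ i → all? λ j → all? λ l →
    κ i ≟ κ j →-dec κ l ≟ κ j →-dec (i ≟ j ⊎-dec i ≟ l ⊎-dec j ≟ l)

  module _ {δ : ℚ} (0<δ : 0ℚ ℚ.< δ) {n : ℕ} (n-large : n ℕ.≥ 4 ℕ.* ℚ.denominatorℕ δ) where

    abstract
      edges⇒dense : ∀ K e {φ} → φ ≡ 1/ K → + n * + n ≤ + ℕ.suc K * (+ 2 * + e + + 4 * + n) →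
        (φ ℚ.- δ) ℚ.* halfSq n ℚ.≤ ℕtoℚ e
      edges⇒dense K e refl h = edges⇒density K (ℚ.- δ) n e
        (subst₂ (λ Q P → (Q + P * + ℕ.suc K) * (+ n * + n) ≤ + ℕ.suc K * Q * (+ 2 * + e))
          (sym (ℚ.↧-neg δ)) (sym (ℚ.↥-neg δ))
          (below-density (+ ℕ.suc K) (ℚ.denominator δ) (ℚ.numerator δ) (+ n) (+ 2 * + e) (0<+suc K)
            (numerator-pos 0<δ) (nat _) (nat n)
            (subst (_≤ + n) (pos-* 4 (ℚ.denominatorℕ δ)) (+≤+ n-large)) h))

    -- `H + H * suc H` is (H + 1)² - 1, so φ is the density of one clique out of H + 1. A path never
    -- leaves its clique, and a clique has at most two colours.
    clique-graphs : ∀ {k H} (κ : Fin k → Fin (ℕ.suc H)) →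
      (∀ i j l → κ i ≡ κ j → κ l ≡ κ j → i ≡ j ⊎ i ≡ l ⊎ j ≡ l) →
      ∀ {φ} → φ ≡ 1/ (H ℕ.+ H ℕ.* ℕ.suc H) →
      ∃[ G ] (∀ (i : Fin k) → (φ ℚ.- δ) ℚ.* halfSq n ℚ.≤ ℕtoℚ (edgeCount {n} (G i))) × ¬ RainbowP3 {n} {k} G
    clique-graphs {k} {H} κ two-per-block {φ} φ≡ = (λ i → blockGraph (κ i)) , dense , rainbow-free
      where
      s : ℕ
      s = n ℕ./ ℕ.suc H
      open Blocks n s (ℕ.suc H) (blocks≤n n ℕ.≤-refl) (λ _ → ⊥) (λ _ → no λ ()) (λ _ ())
      dense : ∀ i → (φ ℚ.- δ) ℚ.* halfSq n ℚ.≤ ℕtoℚ (edgeCount (blockGraph (κ i)))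
      dense i = edges⇒dense (H ℕ.+ H ℕ.* ℕ.suc H) (edgeCount (blockGraph (κ i))) φ≡
        (subst (λ z → + n * + n ≤ z * (+ 2 * + edgeCount (blockGraph (κ i)) + + 4 * + n)) (sym (pos-* (ℕ.suc H) (ℕ.suc H)))
          (clique-count (+ n) (+ s) (+ (n ℕ.% ℕ.suc H)) (+ ℕ.suc H) (+ 2 * + edgeCount (blockGraph (κ i)))
            (division n H) (nat n) (nat s) (+≤+ (ℕ.m%n≤m n (ℕ.suc H))) (remainder≤ n H) (0<+suc H)
            (subst (λ z → + s * + s + + 2 * + s * z ≤ + 2 * + edgeCount (blockGraph (κ i)) + + n) (sum-0 n)
              (block-edges (κ i)))))
      rainbow-free : ¬ RainbowP3 (λ i → blockGraph (κ i))
      rainbow-free (_ , _ , _ , _ , i₁ , i₂ , i₃ , _ , (i₁≢i₂ , i₁≢i₃ , i₂≢i₃) , e₁ , e₂ , e₃)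
        with path-one-block (λ _ ()) (edge⇒joined (κ i₁) e₁) (edge⇒joined (κ i₂) e₂) (edge⇒joined (κ i₃) e₃)
      ... | κ₁≡κ₂ , κ₃≡κ₂ = [ i₁≢i₂ , [ i₁≢i₃ , i₂≢i₃ ]′ ]′ (two-per-block i₁ i₂ i₃ κ₁≡κ₂ κ₃≡κ₂)

    clique-table : ∀ {k} H (t : Vec (Fin (ℕ.suc H)) k) {_ : True (two-per-block? (lookup t))} →
      ∀ {φ} → φ ≡ 1/ (H ℕ.+ H ℕ.* ℕ.suc H) →
      ∃[ G ] (∀ (i : Fin k) → (φ ℚ.- δ) ℚ.* halfSq n ℚ.≤ ℕtoℚ (edgeCount {n} (G i))) × ¬ RainbowP3 {n} {k} G
    clique-table H t {check} = clique-graphs (lookup t) (toWitness check)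

    -- There are k = H + 1 colours, and `1/ (H + H)` is 1/(2k - 1).
    star-graphs : ∀ H {φ} → φ ≡ 1/ (H ℕ.+ H) →
      ∃[ G ] (∀ (i : Fin (ℕ.suc H)) → (φ ℚ.- δ) ℚ.* halfSq n ℚ.≤ ℕtoℚ (edgeCount {n} (G i)))
             × ¬ RainbowP3 {n} {ℕ.suc H} G
    star-graphs H {φ} φ≡ = blockGraph , dense , rainbow-free
      where
      K s ρ : ℕ
      K = H ℕ.+ H
      s = n ℕ./ ℕ.suc K
      ρ = n ℕ.% ℕ.suc K
      Hs≤n : ℕ.suc H ℕ.* s ℕ.≤ n
      Hs≤n = blocks≤n n (ℕ.s≤s (ℕ.m≤m+n H H))
      open Blocks n s (ℕ.suc H) Hs≤n (λ v → ℕ.suc H ℕ.* s ℕ.≤ toℕ v) (λ v → _ ℕ.≤? _) (λ _ h → h)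
      K≡ : + ℕ.suc K ≡ + 2 * + ℕ.suc H - + 1
      K≡ = trans (pos-+ (ℕ.suc H) H) (lem (+ ℕ.suc H) (+ H) (pos-+ 1 H))
        where
        lem : ∀ x y → x ≡ + 1 + y → x + y ≡ + 2 * x - + 1
        lem x y refl = solve (y ∷ [])
      sum-o : sum o ≡ + n - + ℕ.suc H * + s
      sum-o = begin
        sum o                         ≡⟨ sum-cong-≗ {n} o≡ ⟩
        sum (λ v → + 1 - below v)     ≡⟨ sum-minus (λ _ → + 1) below ⟩
        sum {n} (λ _ → + 1) - sum below
          ≡⟨ cong₂ _-_ (trans (sum-const n (+ 1)) (*-identityʳ (+ n)))
                       (trans (count-below (ℕ.suc H ℕ.* s) Hs≤n) (pos-* (ℕ.suc H) s)) ⟩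
        + n - + ℕ.suc H * + s ∎
        where
        open ≡-Reasoning
        below : Fin n → ℤ
        below v = indicator (toℕ v ℕ.<? ℕ.suc H ℕ.* s)
        o≡ : ∀ v → o v ≡ + 1 - below v
        o≡ v with toℕ v ℕ.<? ℕ.suc H ℕ.* s
        ... | yes v< = indicator-no (ℕ.suc H ℕ.* s ℕ.≤? toℕ v) (ℕ.<⇒≱ v<)
        ... | no  v≮ = indicator-yes (ℕ.suc H ℕ.* s ℕ.≤? toℕ v) (ℕ.≮⇒≥ v≮)
      dense : ∀ i → (φ ℚ.- δ) ℚ.* halfSq n ℚ.≤ ℕtoℚ (edgeCount (blockGraph i))
      dense i = edges⇒dense K (edgeCount (blockGraph i)) φ≡
        (star-count (+ n) (+ s) (+ ρ) (+ ℕ.suc H) (+ ℕ.suc K) (+ 2 * + edgeCount (blockGraph i)) K≡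
          (division n K) (nat n) (nat ρ) (nat (ℕ.suc K)) (+≤+ (ℕ.m%n≤m n (ℕ.suc K))) (remainder≤ n K)
          (subst (λ z → + s * + s + + 2 * + s * z ≤ + 2 * + edgeCount (blockGraph i) + + n) sum-o (block-edges i)))
      rainbow-free : ¬ RainbowP3 blockGraph
      rainbow-free (_ , _ , _ , _ , i₁ , i₂ , i₃ , _ , (i₁≢i₂ , i₁≢i₃ , i₂≢i₃) , e₁ , e₂ , e₃)
        with path-blocks (edge⇒joined i₁ e₁) (edge⇒joined i₂ e₂) (edge⇒joined i₃ e₃)
      ... | inj₁ i₁≡i₂ = i₁≢i₂ i₁≡i₂
      ... | inj₂ i₃≡i₂ = i₂≢i₃ (sym i₃≡i₂)

    rainbow-free-graphs : ∀ k → k ℕ.≥ 1 →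
      ∃[ G ] (∀ (i : Fin k) → (f k ℚ.- δ) ℚ.* halfSq n ℚ.≤ ℕtoℚ (edgeCount {n} (G i))) × ¬ RainbowP3 {n} {k} G
    rainbow-free-graphs 1 _ = clique-table 0 (0F Vec.∷ Vec.[]) {φ = f 1} refl
    rainbow-free-graphs 2 _ = clique-table 0 (0F Vec.∷ 0F Vec.∷ Vec.[]) {φ = f 2} refl
    rainbow-free-graphs 3 _ = clique-table 1 (0F Vec.∷ 0F Vec.∷ 1F Vec.∷ Vec.[]) {φ = f 3} refl
    rainbow-free-graphs 4 _ = clique-table 1 (0F Vec.∷ 0F Vec.∷ 1F Vec.∷ 1F Vec.∷ Vec.[]) {φ = f 4} refl
    rainbow-free-graphs 5 _ = clique-table 2 (0F Vec.∷ 0F Vec.∷ 1F Vec.∷ 1F Vec.∷ 2F Vec.∷ Vec.[]) {φ = f 5} refl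
    rainbow-free-graphs 6 _ = clique-table 2 (0F Vec.∷ 0F Vec.∷ 1F Vec.∷ 1F Vec.∷ 2F Vec.∷ 2F Vec.∷ Vec.[]) {φ = f 6} refl
    rainbow-free-graphs (ℕ.suc (ℕ.suc (ℕ.suc (ℕ.suc (ℕ.suc (ℕ.suc (ℕ.suc m))))))) _ =
      star-graphs (6 ℕ.+ m) {f (7 ℕ.+ m)} (cong 1/_ (twice m))
      where
      twice : ∀ m → 12 ℕ.+ 2 ℕ.* m ≡ 6 ℕ.+ m ℕ.+ (6 ℕ.+ m)
      twice = ℕ-Solver.solve-∀

open import Data.Rational using (ℚ; 0ℚ; _+_; _-_; _*_; _≤_; _<_)
import Data.Nat as ℕ
import Data.Rational as ℚ

theorem1 : (∀ (ε : ℚ) → 0ℚ < ε →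
    ∃[ n₀ ] ∀ (n : ℕ) → n ≥ n₀ → ∀ (k : ℕ) → k ≥ 1 →
    (G : Fin k → Graph n) →
    (∀ i → (f k + ε) * halfSq n ≤ ℕtoℚ (edgeCount (G i))) →
    RainbowP3 G)
    ×
    (∀ (k : ℕ) → k ≥ 1 → ∀ (δ : ℚ) → 0ℚ < δ →
    ∃[ n₀ ] ∀ (n : ℕ) → n ≥ n₀ →
    ∃[ G ] ((∀ (i : Fin k) → (f k - δ) * halfSq n ≤ ℕtoℚ (edgeCount {n} (G i)))
    × ¬ RainbowP3 {n} {k} G))
theorem1 =
  -- The threshold is the same for all k, since ε is at least the reciprocal of its denominator.
  (λ ε 0<ε → 7 ℕ.* ℚ.denominatorℕ ε , λ n n-large → RainbowPaths.dense⇒rainbow 0<ε n-large) ,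
  (λ k k≥1 δ 0<δ → 4 ℕ.* ℚ.denominatorℕ δ , λ n n-large → RainbowPaths.rainbow-free-graphs 0<δ n-large k k≥1)
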